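{- Let $q\ge 3$ be a prime power and let $V=GF(q)^5$. Let $qK_{5;\{2,4\}}$ be the graph whose vertices are the flags of type $\{2,4\}$ of $V$ (pairs $\{\alpha,\beta\}$ of subspaces with $\alpha\subset\beta$, $\dim\alpha=2$, $\dim\beta=4$), two flags $F,G$ being adjacent if and only if they are in general position, i.e.\ for all $\alpha\in F$ and $\beta\in G$ one has $\alpha\cap\beta=\{0\}$ or $\alpha+\beta=V$. Then the chromatic number of $qK_{5;\{2,4\}}$ is $\frac{q^4-1}{q-1}=q^3+q^2+q+1$. Moreover, in every coloring of $qK_{5;\{2,4\}}$ with $q^3+q^2+q+1$ colors, each color class is contained in a unique point-pencil, and the base points of the point-pencils so obtained are exactly the $1$-dimensional subspaces of a fixed $4$-dimensional subspace of $V$.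
   Context: For a $1$-dimensional subspace $T$ of $V$, the point-pencil with base point $T$ is the set of all flags $F$ of type $\{2,4\}$ such that $F\cup\{T\}$ is a flag, i.e.\ all flags $\{\alpha,\beta\}$ of type $\{2,4\}$ with $T\subseteq\alpha$. A flag of $V$ is a set of nontrivial subspaces (different from $\{0\}$ and $V$) that are pairwise comparable under inclusion; its type is the set of dimensions of its members. -}

module Defs where

open import Level using (0ℓ)
open import Algebra.Bundles using (CommutativeRing)
open import Data.Nat using (ℕ; zero; suc; _^_; _≤_)
open import Data.Nat.Primality using (Prime)
open import Data.Fin using (Fin)
import Data.Fin as Fin
open import Data.Product using (Σ; ∃; ∃-syntax; _×_; _,_)
open import Data.Sum using (_⊎_)
open import Relation.Nullary using (¬_)
open import Relation.Binary.PropositionalEquality using (_≡_; _≢_)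
open import Function.Bundles using (_⇔_)

record Field : Set₁ where
  field
    commRing : CommutativeRing 0ℓ 0ℓ
  open CommutativeRing commRing public
  field
    1≉0     : ¬ (1# ≈ 0#)
    inverse : ∀ x → ¬ (x ≈ 0#) → ∃[ y ] (x * y ≈ 1#)

record HasSize (F : Field) (q : ℕ) : Set where
  open Field F
  field
    enum      : Fin q → Carrier
    enum-inj  : ∀ i j → enum i ≈ enum j → i ≡ j
    enum-surj : ∀ x → ∃[ i ] (enum i ≈ x)

IsPrimePower : ℕ → Set
IsPrimePower q = ∃[ p ] ∃[ k ] (Prime p × q ≡ p ^ suc k)

module Space (F : Field) (n : ℕ) where
  open Field F

  V : Set
  V = Fin n → Carrier

  _≈v_ : V → V → Set
  u ≈v w = ∀ i → u i ≈ w i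

  0v : V
  0v _ = 0#

  _+v_ : V → V → V
  (u +v w) i = u i + w i

  _·v_ : Carrier → V → V
  (a ·v u) i = a * u i

  lincomb : ∀ {d} → (Fin d → Carrier) → (Fin d → V) → V
  lincomb {zero}  c b = 0v
  lincomb {suc d} c b = (c Fin.zero ·v b Fin.zero) +v lincomb (λ i → c (Fin.suc i)) (λ i → b (Fin.suc i))

  record Subspace : Set₁ where
    field
      _∈_     : V → Set
      ∈-resp  : ∀ {u w} → u ≈v w → _∈_ u → _∈_ w
      0∈      : _∈_ 0v
      +∈      : ∀ {u w} → _∈_ u → _∈_ w → _∈_ (u +v w)
      ·∈      : ∀ a {u} → _∈_ u → _∈_ (a ·v u)
  open Subspace public

  _⊆_ : Subspace → Subspace → Set
  W ⊆ U = ∀ v → _∈_ W v → _∈_ U v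

  _≐_ : Subspace → Subspace → Set
  W ≐ U = (W ⊆ U) × (U ⊆ W)

  HasDim : Subspace → ℕ → Set
  HasDim W d = Σ (Fin d → V) λ b →
      (∀ i → _∈_ W (b i))
    × (∀ c → lincomb c b ≈v 0v → ∀ i → c i ≈ 0#)
    × (∀ v → _∈_ W v → ∃[ c ] (v ≈v lincomb c b))

  TrivialMeet : Subspace → Subspace → Set
  TrivialMeet W U = ∀ v → _∈_ W v → _∈_ U v → v ≈v 0v

  SpanAll : Subspace → Subspace → Set
  SpanAll W U = ∀ v → ∃[ w ] ∃[ u ] (_∈_ W w × _∈_ U u × v ≈v (w +v u))

  GenPos : Subspace → Subspace → Set
  GenPos W U = TrivialMeet W U ⊎ SpanAll W U

module Flags (F : Field) where
  open Field F
  open Space F 5 public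

  record Flag24 : Set₁ where
    field
      α    : Subspace
      β    : Subspace
      α⊆β  : α ⊆ β
      dimα : HasDim α 2
      dimβ : HasDim β 4
  open Flag24 public

  _≐F_ : Flag24 → Flag24 → Set
  P ≐F Q = (α P ≐ α Q) × (β P ≐ β Q)

  Adjacent : Flag24 → Flag24 → Set
  Adjacent P Q = GenPos (α P) (α Q) × GenPos (α P) (β Q)
               × GenPos (β P) (α Q) × GenPos (β P) (β Q)

  record Colouring (k : ℕ) : Set₁ where
    field
      colour  : Flag24 → Fin k
      resp    : ∀ P Q → P ≐F Q → colour P ≡ colour Q
      proper  : ∀ P Q → Adjacent P Q → colour P ≢ colour Q
  open Colouring public

  ChromaticNumber : ℕ → Set₁
  ChromaticNumber N = Colouring N × (∀ k → Colouring k → N ≤ k)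

  -- point-pencil with base point T (T 1-dimensional): flags {α,β} with T ⊆ α.
  -- the colour class i of c is contained in the point-pencil with base T
  ClassInPencil : ∀ {k} → Colouring k → Fin k → Subspace → Set₁
  ClassInPencil c i T = ∀ P → colour c P ≡ i → T ⊆ α P

  UniquePencil : ∀ {k} → Colouring k → Fin k → Set₁
  UniquePencil c i = Σ Subspace λ T → HasDim T 1 × ClassInPencil c i T
    × (∀ T' → HasDim T' 1 → ClassInPencil c i T' → T' ≐ T)

  BasePointsHyperplane : ∀ {k} → Colouring k → Set₁
  BasePointsHyperplane {k} c = Σ Subspace λ H → HasDim H 4 ×
    (∀ T → HasDim T 1 → (T ⊆ H → ∃[ i ] ClassInPencil c i T)
                       × (∃[ i ] ClassInPencil c i T → T ⊆ H))

{-# OPTIONS --safe #-}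

-- Write t = q² + q + 1 and N = q³ + q² + q + 1, and call 2- and 4-dimensional subspaces lines and solids. If (ℓ,S) and
-- (ℓ′,S′) have the same colour and ℓ, ℓ′ are disjoint, then ℓ ⊆ S′ or ℓ′ ⊆ S. Call a line heavy for a colour class if it
-- occurs there with two solids, and light if it occurs with one. A heavy line lies in the solid of every flag of the
-- class whose line it misses, so heavy lines pairwise meet. It follows that a class contained in no point-pencil has at
-- most t heavy lines, and that h heavy and l light lines satisfy (q + 1)(t h + l) < (q⁴ + t) t.
--
-- Suppose that m > 0 of the N classes lie in no point-pencil. At least m (q⁴ + m) / (q + 1) lines miss the base points of
-- the other classes, and the t flags on such a line have colours among those m. There are so many of these lines that
-- one of them is heavy for none of the m classes; its t flags have different colours, whence m ≥ t. But then the m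
-- classes are too small to contain all flags on these lines. Hence all classes lie in point-pencils, and the N base
-- points block all lines. Seen from an uncovered point the base points lie on different lines, so the line joining two
-- of them is covered by them, and they are the points of a hyperplane.
module Submission where

open import Defs
open import Data.Nat using (ℕ; zero; suc; _+_; _*_; _^_; _≤_; _<_; z≤n; s≤s)
open import Data.Nat.Properties hiding (_≟_; suc-injective)
open import Data.Nat.Solver using (module +-*-Solver)
open +-*-Solver using (solve; con; _:+_; _:*_; _:^_; _:=_)
open import Data.Fin using (Fin; zero; suc; toℕ; fromℕ<; inject≤; finToFun; funToFin; combine)
open import Data.Fin.Properties using (any?; all?; _≟_; suc-injective; toℕ<n; toℕ-fromℕ<; toℕ-inject≤; inject≤-injective; finToFun-funToFin; funToFin-finToFin)
open import Data.Fin.Permutation using (permutation)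
open import Data.Product using (∃; ∃-syntax; Σ-syntax; _×_; _,_; proj₁; proj₂)
open import Data.Sum using (_⊎_; inj₁; inj₂; [_,_]′)
open import Function using (_∘_)
open import Relation.Nullary using (¬_; Dec; yes; no; contradiction; ¬?)
open import Relation.Nullary.Decidable using (_×-dec_; _⊎-dec_; _→-dec_; map′; decidable-stable; recompute)
open import Relation.Unary using (Decidable)
open import Relation.Binary.PropositionalEquality using (_≡_; _≢_; refl; sym; trans; cong; cong₂; subst; subst₂)
import Algebra.Properties.Ring as RingProperties
import Algebra.Properties.Group as GroupProperties

-- The expression t h + l counts flags: a line lies in t solids, so a class has at most t flags on a
-- heavy line and one on a light line. The m exceptional classes share t flags on each of m (q⁴ + m)
-- / (q + 1) lines, so one of them would have (q + 1)(t h + l) ≥ (q⁴ + m) t. The bound contradicts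
-- this once m ≥ t, which explains the detour through a line that is heavy for no class: for q = 3
-- one case of the classification only gives 1216 as an upper bound for the left side, whereas (q⁴ +
-- m) t is 1209 for m = 12 and 1222 for m = 13. The subspaces of the statement are arbitrary
-- predicates. The proof works instead with decidable subsets of a finite set numbering the vectors,
-- where dimension is a matter of cardinality and case distinctions are finite searches. Lines are
-- counted through their ordered bases, so the inequalities appear multiplied by `bases p`.

module FiniteCounting where

  -- Counting elements and pairs that satisfy decidable predicates

  open import Algebra.Properties.CommutativeMonoid.Sum +-0-commutativeMonoid
    using (sum; sum-cong-≗; ∑-distrib-+; ∑-comm; sum-permute) public
  open import Algebra.Properties.Semiring.Sum +-*-semiring using (*-distribˡ-sum; *-distribʳ-sum) public

  private
    variable
      n m : ℕ

  ⟦_⟧ : {A : Set} → Dec A → ℕ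
  ⟦ yes _ ⟧ = 1
  ⟦ no _ ⟧ = 0

  ⟦⟧≤1 : {A : Set} (A? : Dec A) → ⟦ A? ⟧ ≤ 1
  ⟦⟧≤1 (yes _) = ≤-refl
  ⟦⟧≤1 (no _)  = z≤n

  ⟦⟧-true : {A : Set} (A? : Dec A) → A → ⟦ A? ⟧ ≡ 1
  ⟦⟧-true (yes _) _ = refl
  ⟦⟧-true (no ¬a) a = contradiction a ¬a

  ⟦⟧-false : {A : Set} (A? : Dec A) → ¬ A → ⟦ A? ⟧ ≡ 0
  ⟦⟧-false (yes a) ¬a = contradiction a ¬a
  ⟦⟧-false (no _) _ = refl

  ⟦⟧-mono : {A B : Set} (A? : Dec A) (B? : Dec B) → (A → B) → ⟦ A? ⟧ ≤ ⟦ B? ⟧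
  ⟦⟧-mono (no _)  _  _ = z≤n
  ⟦⟧-mono (yes a) B? f = ≤-reflexive (sym (⟦⟧-true B? (f a)))

  ⟦⟧-cong : {A B : Set} (A? : Dec A) (B? : Dec B) → (A → B) → (B → A) → ⟦ A? ⟧ ≡ ⟦ B? ⟧
  ⟦⟧-cong A? B? f g = ≤-antisym (⟦⟧-mono A? B? f) (⟦⟧-mono B? A? g)

  ⟦⟧-⊎ : {A B C : Set} (A? : Dec A) (B? : Dec B) (C? : Dec C) → (A → B ⊎ C) → ⟦ A? ⟧ ≤ ⟦ B? ⟧ + ⟦ C? ⟧
  ⟦⟧-⊎ (no _)  _  _ _ = z≤n
  ⟦⟧-⊎ (yes a) B? C? f with f a
  ... | inj₁ b = ≤-trans (≤-reflexive (sym (⟦⟧-true B? b))) (m≤m+n _ _)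
  ... | inj₂ c = ≤-trans (≤-reflexive (sym (⟦⟧-true C? c))) (m≤n+m _ ⟦ B? ⟧)

  sum-mono : {f g : Fin n → ℕ} → (∀ i → f i ≤ g i) → sum f ≤ sum g
  sum-mono {zero}  h = z≤n
  sum-mono {suc n} h = +-mono-≤ (h zero) (sum-mono (h ∘ suc))

  sum-mono-< : {f g : Fin n → ℕ} → (∀ i → f i ≤ g i) → ∀ j → f j < g j → sum f < sum g
  sum-mono-< h zero    l = +-mono-<-≤ l (sum-mono (h ∘ suc))
  sum-mono-< h (suc j) l = +-mono-≤-< (h zero) (sum-mono-< (h ∘ suc) j l)

  sum-const : ∀ n k → sum {n} (λ _ → k) ≡ n * k
  sum-const zero    k = refl
  sum-const (suc n) k = cong (k +_) (sum-const n k)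

  term≤sum : (f : Fin n → ℕ) → ∀ i → f i ≤ sum f
  term≤sum f zero    = m≤m+n _ _
  term≤sum f (suc i) = ≤-trans (term≤sum (f ∘ suc) i) (m≤n+m _ (f zero))

  cnt : {P : Fin n → Set} → Decidable P → ℕ
  cnt P? = sum λ i → ⟦ P? i ⟧

  cnt-mono : {P Q : Fin n → Set} (P? : Decidable P) (Q? : Decidable Q) → (∀ {i} → P i → Q i) → cnt P? ≤ cnt Q?
  cnt-mono P? Q? h = sum-mono λ i → ⟦⟧-mono (P? i) (Q? i) h

  cnt-⊎ : {P Q R : Fin n → Set} (P? : Decidable P) (Q? : Decidable Q) (R? : Decidable R) →
          (∀ {i} → P i → Q i ⊎ R i) → cnt P? ≤ cnt Q? + cnt R?
  cnt-⊎ P? Q? R? h = ≤-trans (sum-mono λ i → ⟦⟧-⊎ (P? i) (Q? i) (R? i) h)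
                             (≤-reflexive (∑-distrib-+ (λ i → ⟦ Q? i ⟧) (λ i → ⟦ R? i ⟧)))

  cnt≤n : {P : Fin n → Set} (P? : Decidable P) → cnt P? ≤ n
  cnt≤n {n} P? = ≤-trans (sum-mono λ i → ⟦⟧≤1 (P? i)) (≤-reflexive (trans (sum-const n 1) (*-identityʳ n)))

  cnt-all : {P : Fin n → Set} (P? : Decidable P) → (∀ i → P i) → cnt P? ≡ n
  cnt-all {n} P? h = trans (sum-cong-≗ (λ i → ⟦⟧-true (P? i) (h i))) (trans (sum-const n 1) (*-identityʳ n))

  cnt-none : {P : Fin n → Set} (P? : Decidable P) → (∀ i → ¬ P i) → cnt P? ≡ 0
  cnt-none {n} P? h = trans (sum-cong-≗ (λ i → ⟦⟧-false (P? i) (h i))) (trans (sum-const n 0) (*-zeroʳ n))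

  cnt-⊆-full : {P Q : Fin n → Set} (P? : Decidable P) (Q? : Decidable Q) → (∀ {i} → P i → Q i) →
               cnt Q? ≤ cnt P? → ∀ {i} → Q i → P i
  cnt-⊆-full P? Q? h le {i} q with P? i in eq
  ... | yes p = p
  ... | no _ = contradiction le (<⇒≱ (sum-mono-< (λ j → ⟦⟧-mono (P? j) (Q? j) h) i
          (subst₂ _<_ (cong ⟦_⟧ (sym eq)) (sym (⟦⟧-true (Q? i) q)) (s≤s z≤n))))

  cnt-unique : {P : Fin n → Set} (P? : Decidable P) → (∀ {i j} → P i → P j → i ≡ j) → cnt P? ≤ 1
  cnt-unique {zero}  P? u = z≤n
  cnt-unique {suc n} P? u with P? zero
  ... | no _  = cnt-unique (P? ∘ suc) λ p p′ → suc-injective (u p p′)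
  ... | yes p = ≤-reflexive (cong suc (cnt-none (P? ∘ suc) λ i p′ → contradiction (u p p′) λ ()))

  cnt-pos : {P : Fin n → Set} (P? : Decidable P) → 1 ≤ cnt P? → ∃ P
  cnt-pos P? le with any? P?
  ... | yes e = e
  ... | no ¬e = contradiction (subst (1 ≤_) (cnt-none P? λ i p → ¬e (i , p)) le) λ ()

  cnt-¬ : {P Q : Fin n → Set} (P? : Decidable P) (Q? : Decidable Q) →
          (∀ {i} → ¬ P i → Q i) → (∀ {i} → Q i → ¬ P i) → cnt P? + cnt Q? ≡ n
  cnt-¬ {n} {P} {Q} P? Q? f g =
    trans (sym (∑-distrib-+ (λ i → ⟦ P? i ⟧) (λ i → ⟦ Q? i ⟧)))
          (trans (sum-cong-≗ λ i → one (P? i) (Q? i)) (trans (sum-const n 1) (*-identityʳ n)))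
    where
    one : ∀ {i} (p : Dec (P i)) (q : Dec (Q i)) → ⟦ p ⟧ + ⟦ q ⟧ ≡ 1
    one (yes p) q = cong suc (⟦⟧-false q λ y → g y p)
    one (no ¬p) q = ⟦⟧-true q (f ¬p)

  cnt-⊎-disjoint : {P Q R : Fin n → Set} (P? : Decidable P) (Q? : Decidable Q) (R? : Decidable R) →
          (∀ {i} → R i → P i ⊎ Q i) → (∀ {i} → P i → R i × ¬ Q i) → (∀ {i} → Q i → R i) → cnt P? + cnt Q? ≡ cnt R?
  cnt-⊎-disjoint {n} {P} {Q} {R} P? Q? R? h p⇒ q⇒ =
    trans (sym (∑-distrib-+ (λ i → ⟦ P? i ⟧) (λ i → ⟦ Q? i ⟧))) (sum-cong-≗ λ i → each (P? i) (Q? i) (R? i))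
    where
    each : ∀ {i} (p : Dec (P i)) (q : Dec (Q i)) (r : Dec (R i)) → ⟦ p ⟧ + ⟦ q ⟧ ≡ ⟦ r ⟧
    each (yes p) q r = trans (cong suc (⟦⟧-false q (proj₂ (p⇒ p)))) (sym (⟦⟧-true r (proj₁ (p⇒ p))))
    each (no ¬p) q r = ⟦⟧-cong q r q⇒ λ x → [ (λ p → contradiction p ¬p) , (λ y → y) ]′ (h x)

  cnt-∃ : {P : Fin n → Set} {Q : Fin m → Fin n → Set} (P? : Decidable P) (Q? : ∀ k → Decidable (Q k)) →
          (∀ {i} → P i → ∃[ k ] Q k i) → cnt P? ≤ sum λ k → cnt (Q? k)
  cnt-∃ {n} {m} {P} P? Q? h = ≤-trans (sum-mono λ i → each i (P? i)) (≤-reflexive (∑-comm (λ i k → ⟦ Q? k i ⟧)))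
    where
    each : ∀ i (p : Dec (P i)) → ⟦ p ⟧ ≤ sum λ k → ⟦ Q? k i ⟧
    each i (no _)  = z≤n
    each i (yes p) with k , q ← h p = ≤-trans (≤-reflexive (sym (⟦⟧-true (Q? k i) q))) (term≤sum (λ k → ⟦ Q? k i ⟧) k)

  cnt-inverse : {P : Fin n → Set} (P? : Decidable P) (f g : Fin n → Fin n) → (∀ x → f (g x) ≡ x) → (∀ x → g (f x) ≡ x) →
                cnt P? ≡ cnt (λ x → P? (f x))
  cnt-inverse P? f g fg gf = sum-permute (λ x → ⟦ P? x ⟧) (permutation f g fg gf)

  cnt₂ : {P : Fin n → Fin m → Set} → (∀ x y → Dec (P x y)) → ℕ
  cnt₂ P? = sum λ x → cnt (P? x)

  cnt₂-mono : {P Q : Fin n → Fin m → Set} (P? : ∀ x y → Dec (P x y)) (Q? : ∀ x y → Dec (Q x y)) →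
              (∀ {x y} → P x y → Q x y) → cnt₂ P? ≤ cnt₂ Q?
  cnt₂-mono P? Q? h = sum-mono λ x → cnt-mono (P? x) (Q? x) h

  cnt₂-⊎ : {P Q R : Fin n → Fin m → Set} (P? : ∀ x y → Dec (P x y)) (Q? : ∀ x y → Dec (Q x y)) (R? : ∀ x y → Dec (R x y)) →
           (∀ {x y} → P x y → Q x y ⊎ R x y) → cnt₂ P? ≤ cnt₂ Q? + cnt₂ R?
  cnt₂-⊎ P? Q? R? h = ≤-trans (sum-mono λ x → cnt-⊎ (P? x) (Q? x) (R? x) h)
                              (≤-reflexive (∑-distrib-+ (λ x → cnt (Q? x)) (λ x → cnt (R? x))))

  cnt₂-∃ : ∀ {k} {P : Fin n → Fin m → Set} {Q : Fin k → Fin n → Fin m → Set}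
           (P? : ∀ x y → Dec (P x y)) (Q? : ∀ i x y → Dec (Q i x y)) →
           (∀ {x y} → P x y → ∃[ i ] Q i x y) → cnt₂ P? ≤ sum λ i → cnt₂ (Q? i)
  cnt₂-∃ P? Q? h = ≤-trans (sum-mono λ x → cnt-∃ (P? x) (λ i → Q? i x) h)
                           (≤-reflexive (∑-comm λ x i → cnt (Q? i x)))

  cnt₂-×-≤ : {P Q : Fin n → Fin m → Set} {A : Fin n → Set}
             (P? : ∀ x y → Dec (P x y)) (A? : Decidable A) (Q? : ∀ x y → Dec (Q x y)) {a b : ℕ} →
             (∀ {x y} → P x y → A x × Q x y) → cnt A? ≤ a → (∀ {x} → A x → cnt (Q? x) ≤ b) → cnt₂ P? ≤ a * b
  cnt₂-×-≤ {A = A} P? A? Q? {a} {b} h ca cb = ≤-trans (sum-mono λ x → each x (A? x))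
    (≤-trans (≤-reflexive (sym (*-distribʳ-sum b (λ x → ⟦ A? x ⟧)))) (*-monoˡ-≤ b ca))
    where
    each : ∀ x (d : Dec (A x)) → cnt (P? x) ≤ ⟦ d ⟧ * b
    each x (yes y) = ≤-trans (cnt-mono (P? x) (Q? x) (λ p → proj₂ (h p))) (≤-trans (cb y) (≤-reflexive (sym (+-identityʳ b))))
    each x (no ¬y) = ≤-reflexive (cnt-none (P? x) λ _ p → ¬y (proj₁ (h p)))

  cnt₂-×-≥ : {P : Fin n → Fin m → Set} {A : Fin n → Set}
             (P? : ∀ x y → Dec (P x y)) (A? : Decidable A) {a b : ℕ} →
             a ≤ cnt A? → (∀ {x} → A x → b ≤ cnt (P? x)) → a * b ≤ cnt₂ P?
  cnt₂-×-≥ {A = A} P? A? {a} {b} ca cb = ≤-trans (*-monoˡ-≤ b ca)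
    (≤-trans (≤-reflexive (*-distribʳ-sum b (λ x → ⟦ A? x ⟧))) (sum-mono λ x → each x (A? x)))
    where
    each : ∀ x (d : Dec (A x)) → ⟦ d ⟧ * b ≤ cnt (P? x)
    each x (yes y) = ≤-trans (≤-reflexive (+-identityʳ b)) (cb y)
    each x (no ¬y) = z≤n

-- Polynomial identities and inequalities in q

module Arithmetic where

  opaque
    -- `θ₂ q` is the number of points of a plane and of solids on a line; `θ₃ q` is the number of
    -- points of a solid and of lines on a point.
    θ₂ θ₃ : ℕ → ℕ
    θ₂ q = q ^ 2 + q + 1
    θ₃ q = q ^ 3 + q ^ 2 + q + 1

    -- `solidLines q` is the number of lines of a solid. `transversals q` counts the lines that meet
    -- a line U of a solid S and are not in S: U has q + 1 points, and θ₃ q - θ₂ q = q³ of the lines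
    -- on each of them leave S.
    solidLines transversals : ℕ → ℕ
    solidLines q = (q ^ 2 + 1) * θ₂ q
    transversals q = (q + 1) * q ^ 3

    -- The number of ordered bases of a line over a field with suc p elements.
    bases : ℕ → ℕ
    bases p = (p * (suc p + 1)) * (p * suc p)

    q²-1 : ∀ p → suc p ^ 2 ≡ 1 + p * (suc p + 1)
    q²-1 = solve 1 (λ p → let q = con 1 :+ p in q :^ 2 := con 1 :+ p :* (q :+ con 1)) refl

    q²-q : ∀ p → suc p ^ 2 ≡ suc p + p * suc p
    q²-q = solve 1 (λ p → let q = con 1 :+ p in q :^ 2 := q :+ p :* q) refl

    q³-1 : ∀ p → suc p ^ 3 ≡ 1 + p * θ₂ (suc p)
    q³-1 = solve 1 (λ p → let q = con 1 :+ p in q :^ 3 := con 1 :+ p :* (q :^ 2 :+ q :+ con 1)) refl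

    q³-q : ∀ p → suc p ^ 3 ≡ suc p + suc p * (p * (suc p + 1))
    q³-q = solve 1 (λ p → let q = con 1 :+ p in q :^ 3 := q :+ q :* (p :* (q :+ con 1))) refl

    q⁴-1 : ∀ p → suc p ^ 4 ≡ 1 + p * θ₃ (suc p)
    q⁴-1 = solve 1 (λ p → let q = con 1 :+ p in q :^ 4 := con 1 :+ p :* (q :^ 3 :+ q :^ 2 :+ q :+ con 1)) refl

    q⁴-q : ∀ p → suc p ^ 4 ≡ suc p + suc p * (p * θ₂ (suc p))
    q⁴-q = solve 1 (λ p → let q = con 1 :+ p in q :^ 4 := q :+ q :* (p :* (q :^ 2 :+ q :+ con 1))) refl

    q⁴-q² : ∀ p → suc p ^ 4 ≡ suc p ^ 2 + suc p ^ 2 * (p * (suc p + 1))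
    q⁴-q² = solve 1 (λ p → let q = con 1 :+ p in q :^ 4 := q :^ 2 :+ q :^ 2 :* (p :* (q :+ con 1))) refl

    q⁴-q³ : ∀ p → suc p ^ 4 ≡ suc p ^ 3 + suc p ^ 3 * p
    q⁴-q³ = solve 1 (λ p → let q = con 1 :+ p in q :^ 4 := q :^ 3 :+ q :^ 3 :* p) refl

    q⁵-1 : ∀ p → suc p ^ 5 ≡ 1 + p * θ₃ (suc p) + p * suc p ^ 4
    q⁵-1 = solve 1 (λ p → let q = con 1 :+ p in
      q :^ 5 := con 1 :+ p :* (q :^ 3 :+ q :^ 2 :+ q :+ con 1) :+ p :* q :^ 4) refl

    q⁵-q : ∀ p → suc p ^ 5 ≡ suc p + θ₃ (suc p) * (p * suc p)
    q⁵-q = solve 1 (λ p → let q = con 1 :+ p in q :^ 5 := q :+ (q :^ 3 :+ q :^ 2 :+ q :+ con 1) :* (p :* q)) refl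

    q⁵-q² : ∀ p → suc p ^ 5 ≡ suc p ^ 2 + suc p ^ 2 * (p * θ₂ (suc p))
    q⁵-q² = solve 1 (λ p → let q = con 1 :+ p in q :^ 5 := q :^ 2 :+ q :^ 2 :* (p :* (q :^ 2 :+ q :+ con 1))) refl

    q⁵-q³ : ∀ p → suc p ^ 5 ≡ suc p ^ 3 + suc p ^ 3 * (p * (suc p + 1))
    q⁵-q³ = solve 1 (λ p → let q = con 1 :+ p in q :^ 5 := q :^ 3 :+ q :^ 3 :* (p :* (q :+ con 1))) refl

    q⁵-q⁴ : ∀ p → suc p ^ 5 ≡ suc p ^ 4 + p * suc p ^ 4
    q⁵-q⁴ = solve 1 (λ p → let q = con 1 :+ p in q :^ 5 := q :^ 4 :+ p :* q :^ 4) refl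

    -- From here to `lines-meeting`, the left sides count ordered bases as choices of a first vector
    -- times choices of a second; the factor of `bases p` on the right is therefore the number of
    -- lines.
    lines-in-line : ∀ p → (p * (suc p + 1)) * (p * suc p) ≡ 1 * bases p
    lines-in-line = solve 1 (λ p → let q = con 1 :+ p in
      (p :* (q :+ con 1)) :* (p :* q) := con 1 :* ((p :* (q :+ con 1)) :* (p :* q))) refl

    lines-in-plane : ∀ p → (p * θ₂ (suc p)) * (suc p * (p * (suc p + 1))) ≡ θ₂ (suc p) * bases p
    lines-in-plane = solve 1 (λ p → let q = con 1 :+ p ; t = q :^ 2 :+ q :+ con 1 in
      (p :* t) :* (q :* (p :* (q :+ con 1))) := t :* ((p :* (q :+ con 1)) :* (p :* q))) refl

    lines-in-solid : ∀ p → (p * θ₃ (suc p)) * (suc p * (p * θ₂ (suc p))) ≡ solidLines (suc p) * bases p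
    lines-in-solid = solve 1 (λ p → let q = con 1 :+ p ; t = q :^ 2 :+ q :+ con 1 ; N = q :^ 3 :+ q :^ 2 :+ q :+ con 1 in
        (p :* N) :* (q :* (p :* t)) := ((q :^ 2 :+ con 1) :* t) :* ((p :* (q :+ con 1)) :* (p :* q))) refl

    lines-on-point : ∀ p k → p * (suc p * (p * k)) + (suc p * (p * k)) * (p * suc p) ≡ k * bases p
    lines-on-point = solve 2 (λ p k → let q = con 1 :+ p in
        p :* (q :* (p :* k)) :+ (q :* (p :* k)) :* (p :* q) := k :* ((p :* (q :+ con 1)) :* (p :* q))) refl

    lines-meeting : ∀ p → (p * (suc p + 1)) * (p * suc p ^ 4) + (p * suc p ^ 4) * (suc p * (p * (suc p + 1)))
                        ≡ transversals (suc p) * bases p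
    lines-meeting = solve 1 (λ p → let q = con 1 :+ p in
        (p :* (q :+ con 1)) :* (p :* q :^ 4) :+ (p :* q :^ 4) :* (q :* (p :* (q :+ con 1)))
        := ((q :+ con 1) :* q :^ 3) :* ((p :* (q :+ con 1)) :* (p :* q))) refl

    -- The left side counts the pairs z, w that extend a line to a solid, the last factor those
    -- inside one fixed solid; the quotient is the number of solids on the line.
    flags-on-line : ∀ p → (suc p ^ 2 * (p * θ₂ (suc p))) * (suc p ^ 3 * (p * (suc p + 1)))
                        ≡ θ₂ (suc p) * ((suc p ^ 2 * (p * (suc p + 1))) * (suc p ^ 3 * p))
    flags-on-line = solve 1 (λ p → let q = con 1 :+ p ; t = q :^ 2 :+ q :+ con 1 in
        (q :^ 2 :* (p :* t)) :* (q :^ 3 :* (p :* (q :+ con 1)))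
        := t :* ((q :^ 2 :* (p :* (q :+ con 1))) :* (q :^ 3 :* p))) refl

  -- φ heavy and l light lines are few enough for a colour class outside all point-pencils.
  record Small (q φ l : ℕ) : Set where
    field
      heavy≤ : φ ≤ θ₂ q
      total< : (q + 1) * (θ₂ q * φ + l) < (q ^ 4 + θ₂ q) * θ₂ q

  private
    less : ∀ {a b} c → b ≡ suc (a + c) → a < b
    less c refl = s≤s (m≤m+n _ c)

    least : ∀ {a b} c → b ≡ a + c → a ≤ b
    least c refl = m≤m+n _ c

  opaque
    unfolding θ₂

    -- The polynomial in `r` is the slack for q = 3 + r, and all its coefficients are positive. At q
    -- = 3 the two sides of `total<` are 1216 and 1222; at q = 2 the inequality would fail.
    small₁ : ∀ r → let q = 3 + r in Small q 1 (solidLines q + (transversals q + (θ₃ q + θ₂ q)))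
    small₁ r = record
      { heavy≤ = m≤n+m 1 ((3 + r) ^ 2 + (3 + r))
      ; total< = less _ (solve 1 (λ r → let q = con 3 :+ r ; t = q :^ 2 :+ q :+ con 1 ; N = q :^ 3 :+ q :^ 2 :+ q :+ con 1 in
          (q :^ 4 :+ t) :* t := con 1 :+ ((q :+ con 1) :* (t :* con 1 :+ ((q :^ 2 :+ con 1) :* t :+ ((q :+ con 1) :* q :^ 3 :+ (N :+ t))))
          :+ (con 5 :+ con 525 :* r :+ con 723 :* r :^ 2 :+ con 408 :* r :^ 3 :+ con 117 :* r :^ 4 :+ con 17 :* r :^ 5 :+ r :^ 6))) refl r) }

    small₂ : ∀ r → let q = 3 + r in Small q (θ₂ q) (solidLines q)
    small₂ r = record
      { heavy≤ = ≤-refl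
      ; total< = less _ (solve 1 (λ r → let q = con 3 :+ r ; t = q :^ 2 :+ q :+ con 1 in
          (q :^ 4 :+ t) :* t := con 1 :+ ((q :+ con 1) :* (t :* t :+ (q :^ 2 :+ con 1) :* t)
          :+ (con 25 :+ con 534 :* r :+ con 724 :* r :^ 2 :+ con 408 :* r :^ 3 :+ con 117 :* r :^ 4 :+ con 17 :* r :^ 5 :+ r :^ 6))) refl r) }

    small₃ : ∀ r → let q = 3 + r in Small q (q + 1) (θ₃ q + θ₂ q + solidLines q)
    small₃ r = record
      { heavy≤ = least _ (solve 1 (λ r → let q = con 3 :+ r in q :^ 2 :+ q :+ con 1 := (q :+ con 1) :+ q :^ 2) refl r)
      ; total< = less _ (solve 1 (λ r → let q = con 3 :+ r ; t = q :^ 2 :+ q :+ con 1 ; N = q :^ 3 :+ q :^ 2 :+ q :+ con 1 in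
          (q :^ 4 :+ t) :* t := con 1 :+ ((q :+ con 1) :* (t :* (q :+ con 1) :+ (N :+ t :+ (q :^ 2 :+ con 1) :* t))
          :+ (con 281 :+ con 998 :* r :+ con 1036 :* r :^ 2 :+ con 509 :* r :^ 3 :+ con 133 :* r :^ 4 :+ con 18 :* r :^ 5 :+ r :^ 6))) refl r) }

    star+plane≤solid : ∀ r → let q = 3 + r in θ₃ q + θ₂ q ≤ solidLines q
    star+plane≤solid r = least _ (solve 1 (λ r → let q = con 3 :+ r ; t = q :^ 2 :+ q :+ con 1 ; N = q :^ 3 :+ q :^ 2 :+ q :+ con 1 in
      (q :^ 2 :+ con 1) :* t := (N :+ t) :+ (con 77 :+ con 107 :* r :+ con 54 :* r :^ 2 :+ con 12 :* r :^ 3 :+ r :^ 4)) refl r)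

  opaque
    unfolding θ₂ θ₃ bases

    -- Division by m p² q leaves θ₂ q (q + 1) < q⁴ + m. The left side is the most that m classes can
    -- have in bases of heavy lines, the right side the least number of bases of uncovered lines.
    few-heavy-lines : ∀ r m → let q = 3 + r ; p = 2 + r in 1 ≤ m →
      m * (θ₂ q * bases p) < (p * (q ^ 4 + m)) * (m * (p * q))
    few-heavy-lines r (suc k) _ = <-≤-trans (m<m+n _ (s≤s z≤n)) (≤-reflexive (sym
      (solve 2 (λ r k → let q = con 3 :+ r ; p = con 2 :+ r ; t = q :^ 2 :+ q :+ con 1 ; m = con 1 :+ k in
        (p :* (q :^ 4 :+ m)) :* (m :* (p :* q)) :=
        (m :* (t :* ((p :* (q :+ con 1)) :* (p :* q)))) :+
          (m :* (con 30 :+ k :+ (con 67 :* r :+ con 43 :* r :^ 2 :+ con 11 :* r :^ 3 :+ r :^ 4))) :* (p :* (p :* q))) refl r k)))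

    -- Since `bases p` has the factor q + 1, the product m (q⁴ + m) θ₂ q `bases p` is q + 1 times
    -- the lower bound for `X`. With `θ₂ q ≤ m` the last inequality then leaves no room for the
    -- summand `m * bases p`.
    too-many-flags : ∀ r m X → let q = 3 + r ; p = 2 + r in 1 ≤ m → θ₂ q ≤ m →
      θ₂ q * ((p * (q ^ 4 + m)) * (m * (p * q))) ≤ X →
      (q + 1) * X + m * bases p ≤ m * (((q ^ 4 + θ₂ q) * θ₂ q) * bases p) → m * bases p ≤ 0
    too-many-flags r m X 1≤m t≤m h k = +-cancelˡ-≤ ((3 + r + 1) * X) _ _ (≤-trans k (≤-trans
      (*-monoʳ-≤ m (*-monoˡ-≤ (bases (2 + r)) (*-monoˡ-≤ (θ₂ (3 + r)) (+-monoʳ-≤ ((3 + r) ^ 4) t≤m))))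
      (≤-trans (≤-reflexive (solve 2 (λ r m → let q = con 3 :+ r ; p = con 2 :+ r ; t = q :^ 2 :+ q :+ con 1 in
          m :* (((q :^ 4 :+ m) :* t) :* ((p :* (q :+ con 1)) :* (p :* q))) :=
          (q :+ con 1) :* (t :* ((p :* (q :^ 4 :+ m)) :* (m :* (p :* q))))) refl r m))
        (≤-trans (*-monoʳ-≤ (3 + r + 1) h) (≤-reflexive (sym (+-identityʳ _)))))))

    θ₃-def : ∀ q → q ^ 3 + q ^ 2 + q + 1 ≡ θ₃ q
    θ₃-def q = refl

    bases-positive : ∀ r → 1 ≤ bases (2 + r)
    bases-positive r = s≤s z≤n

-- Vector spaces over a finite field, with numbered vectors

module VectorSpace (F : Field) (p : ℕ) (size : HasSize F (suc p)) (d : ℕ) where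

  open FiniteCounting

  private
    module F = Field F
    module Sp = Space F d
    open HasSize size
    module RP = RingProperties F.ring
    module GP = GroupProperties F.+-group

  q : ℕ
  q = suc p

  K : Set
  K = F.Carrier

  -- Opaque, since otherwise sums over all vectors would unfold.
  opaque
    ∣V∣ : ℕ
    ∣V∣ = q ^ d

    ∣V∣≡ : ∣V∣ ≡ q ^ d
    ∣V∣≡ = refl

  V : Set
  V = Fin ∣V∣

  index : K → Fin q
  index a = proj₁ (enum-surj a)

  enum-index : ∀ a → enum (index a) F.≈ a
  enum-index a = proj₂ (enum-surj a)

  _≈?_ : ∀ a b → Dec (a F.≈ b)
  a ≈? b = map′
    (λ e → F.trans (F.sym (enum-index a)) (F.trans (F.reflexive (cong enum e)) (enum-index b)))
    (λ e → enum-inj _ _ (F.trans (enum-index a) (F.trans e (F.sym (enum-index b)))))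
    (index a ≟ index b)

  private
    funToFin-cong : ∀ {m n} {f g : Fin m → Fin n} → (∀ i → f i ≡ g i) → funToFin f ≡ funToFin g
    funToFin-cong {zero}  h = refl
    funToFin-cong {suc m} h = cong₂ combine (h zero) (funToFin-cong (h ∘ suc))

  -- Vectors up to pointwise equality are numbered by Fin (q ^ d), so that propositional equality can be used below.
  opaque
    unfolding ∣V∣

    vec : V → Sp.V
    vec x i = enum (finToFun x i)

    code : Sp.V → V
    code v = funToFin (index ∘ v)

    vec-code : ∀ v → vec (code v) Sp.≈v v
    vec-code v i = F.trans (F.reflexive (cong enum (finToFun-funToFin (index ∘ v) i))) (enum-index (v i))

    vec-injective : ∀ {x y} → vec x Sp.≈v vec y → x ≡ y
    vec-injective {x} {y} h = trans (sym (funToFin-finToFin {d} x))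
      (trans (funToFin-cong (λ i → enum-inj _ _ (h i))) (funToFin-finToFin {d} y))

    code-cong : ∀ {u v} → u Sp.≈v v → code u ≡ code v
    code-cong h = vec-injective λ i → F.trans (vec-code _ i) (F.trans (h i) (F.sym (vec-code _ i)))

    code-vec : ∀ x → code (vec x) ≡ x
    code-vec x = vec-injective (vec-code (vec x))

  infixl 6 _⊕_
  infixr 7 _·_

  opaque
    _⊕_ : V → V → V
    x ⊕ y = code (vec x Sp.+v vec y)

    _·_ : K → V → V
    a · x = code (a Sp.·v vec x)

    𝟘 : V
    𝟘 = code Sp.0v

    vec-⊕ : ∀ x y → vec (x ⊕ y) Sp.≈v (vec x Sp.+v vec y)
    vec-⊕ x y = vec-code _

    vec-· : ∀ a x → vec (a · x) Sp.≈v (a Sp.·v vec x)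
    vec-· a x = vec-code _

    vec-𝟘 : vec 𝟘 Sp.≈v Sp.0v
    vec-𝟘 = vec-code _

  private
    pull-⊕ : ∀ {x y u v} → vec x Sp.≈v u → vec y Sp.≈v v → vec (x ⊕ y) Sp.≈v (u Sp.+v v)
    pull-⊕ h k i = F.trans (vec-⊕ _ _ i) (F.+-cong (h i) (k i))

    pull-· : ∀ a {x u} → vec x Sp.≈v u → vec (a · x) Sp.≈v (a Sp.·v u)
    pull-· a h i = F.trans (vec-· _ _ i) (F.*-congˡ (h i))

    v₁ : ∀ {x} → vec x Sp.≈v vec x
    v₁ i = F.refl

  abstract
    ⊕-assoc : ∀ x y z → (x ⊕ y) ⊕ z ≡ x ⊕ (y ⊕ z)
    ⊕-assoc x y z = vec-injective λ i → F.trans (pull-⊕ (vec-⊕ x y) v₁ i)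
      (F.trans (F.+-assoc _ _ _) (F.sym (pull-⊕ v₁ (vec-⊕ y z) i)))

    ⊕-comm : ∀ x y → x ⊕ y ≡ y ⊕ x
    ⊕-comm x y = vec-injective λ i → F.trans (vec-⊕ x y i) (F.trans (F.+-comm _ _) (F.sym (vec-⊕ y x i)))

    ⊕-identityʳ : ∀ x → x ⊕ 𝟘 ≡ x
    ⊕-identityʳ x = vec-injective λ i → F.trans (pull-⊕ v₁ vec-𝟘 i) (F.+-identityʳ _)

    ·-distribˡ : ∀ a x y → a · (x ⊕ y) ≡ a · x ⊕ a · y
    ·-distribˡ a x y = vec-injective λ i → F.trans (pull-· a (vec-⊕ x y) i)
      (F.trans (F.distribˡ _ _ _) (F.sym (pull-⊕ (vec-· a x) (vec-· a y) i)))

    ·-distribʳ : ∀ a b x → (a F.+ b) · x ≡ a · x ⊕ b · x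
    ·-distribʳ a b x = vec-injective λ i → F.trans (vec-· _ x i)
      (F.trans (F.distribʳ _ _ _) (F.sym (pull-⊕ (vec-· a x) (vec-· b x) i)))

    ·-assoc : ∀ a b x → (a F.* b) · x ≡ a · (b · x)
    ·-assoc a b x = vec-injective λ i → F.trans (vec-· _ x i)
      (F.trans (F.*-assoc _ _ _) (F.sym (pull-· a (vec-· b x) i)))

    ·-identity : ∀ x → F.1# · x ≡ x
    ·-identity x = vec-injective λ i → F.trans (vec-· _ x i) (F.*-identityˡ _)

    ·-zeroˡ : ∀ x → F.0# · x ≡ 𝟘
    ·-zeroˡ x = vec-injective λ i → F.trans (vec-· _ x i) (F.trans (F.zeroˡ _) (F.sym (vec-𝟘 i)))

    ·-zeroʳ : ∀ a → a · 𝟘 ≡ 𝟘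
    ·-zeroʳ a = vec-injective λ i → F.trans (pull-· a vec-𝟘 i) (F.trans (F.zeroʳ _) (F.sym (vec-𝟘 i)))

    ·-cong : ∀ {a b} x → a F.≈ b → a · x ≡ b · x
    ·-cong x h = vec-injective λ i → F.trans (vec-· _ x i) (F.trans (F.*-congʳ h) (F.sym (vec-· _ x i)))

    ⊕-cancel : ∀ a x y → (y ⊕ a · x) ⊕ (F.- a) · x ≡ y
    ⊕-cancel a x y = trans (⊕-assoc y _ _) (trans (cong (y ⊕_)
      (trans (sym (·-distribʳ _ _ x)) (trans (·-cong x (F.-‿inverseʳ a)) (·-zeroˡ x)))) (⊕-identityʳ y))

    ⊕-cancel′ : ∀ a x y → (y ⊕ (F.- a) · x) ⊕ a · x ≡ y
    ⊕-cancel′ a x y = trans (⊕-assoc y _ _) (trans (cong (y ⊕_)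
      (trans (sym (·-distribʳ _ _ x)) (trans (·-cong x (F.-‿inverseˡ a)) (·-zeroˡ x)))) (⊕-identityʳ y))

    ⊕-interchange : ∀ a b c e → (a ⊕ b) ⊕ (c ⊕ e) ≡ (a ⊕ c) ⊕ (b ⊕ e)
    ⊕-interchange a b c e = trans (⊕-assoc a b _) (trans (cong (a ⊕_)
      (trans (sym (⊕-assoc b c e)) (trans (cong (_⊕ e) (⊕-comm b c)) (⊕-assoc c b e)))) (sym (⊕-assoc a c _)))

  infix 4 _∈_ _∉_ _∈?_ _⊆_ _⊆?_

  record Sub : Set₁ where
    no-eta-equality
    field
      Mem  : V → Set
      mem? : Decidable Mem
      mem𝟘 : Mem 𝟘
      mem⊕ : ∀ {x y} → Mem x → Mem y → Mem (x ⊕ y)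
      mem· : ∀ a {x} → Mem x → Mem (a · x)
  open Sub public

  record _∈_ (x : V) (W : Sub) : Set where
    constructor mk∈
    field un∈ : Mem W x
  open _∈_ public

  _∉_ : V → Sub → Set
  x ∉ W = ¬ (x ∈ W)

  _∈?_ : ∀ x W → Dec (x ∈ W)
  x ∈? W = map′ mk∈ un∈ (mem? W x)

  _⊆_ : Sub → Sub → Set
  U ⊆ W = ∀ {x} → x ∈ U → x ∈ W

  abstract
    _⊆?_ : ∀ U W → Dec (U ⊆ W)
    U ⊆? W = map′ (λ h {x} → h x) (λ h x → h {x}) (all? λ x → (x ∈? U) →-dec (x ∈? W))

    ⊈-witness : ∀ {U W} → ¬ (U ⊆ W) → ∃[ x ] (x ∈ U × x ∉ W)
    ⊈-witness {U} {W} h with any? (λ x → (x ∈? U) ×-dec ¬? (x ∈? W))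
    ... | yes e = e
    ... | no ¬e = contradiction (λ {x} u → decidable-stable (x ∈? W) λ w → ¬e (x , u , w)) h

  ∈-𝟘 : ∀ W → 𝟘 ∈ W
  ∈-𝟘 W = mk∈ (mem𝟘 W)

  ∈-⊕ : ∀ W {x y} → x ∈ W → y ∈ W → x ⊕ y ∈ W
  ∈-⊕ W (mk∈ x) (mk∈ y) = mk∈ (mem⊕ W x y)

  ∈-· : ∀ W a {x} → x ∈ W → a · x ∈ W
  ∈-· W a (mk∈ x) = mk∈ (mem· W a x)

  abstract
    ∈-⊕⁻ : ∀ W a {x y} → x ∈ W → y ⊕ a · x ∈ W → y ∈ W
    ∈-⊕⁻ W a {x} {y} x∈ h = subst (_∈ W) (⊕-cancel a x y) (∈-⊕ W h (∈-· W (F.- a) x∈))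

    ∈-·⁻ : ∀ W {a x} → ¬ (a F.≈ F.0#) → a · x ∈ W → x ∈ W
    ∈-·⁻ W {a} {x} a≉0 h with b , ab≈1 ← F.inverse a a≉0 =
      subst (_∈ W) (trans (sym (·-assoc b a x)) (trans (·-cong x (F.trans (F.*-comm b a) ab≈1)) (·-identity x))) (∈-· W b h)

  ∅ : Sub
  ∅ = record { Mem = _≡ 𝟘 ; mem? = _≟ 𝟘 ; mem𝟘 = refl
             ; mem⊕ = λ { refl refl → ⊕-identityʳ 𝟘 } ; mem· = λ { a refl → ·-zeroʳ a } }

  ⊤ : Sub
  ⊤ = record { Mem = λ _ → 𝟘 ≡ 𝟘 ; mem? = λ _ → yes refl ; mem𝟘 = refl ; mem⊕ = λ _ _ → refl ; mem· = λ _ _ → refl }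

  infixl 6 _⊹_
  infixl 7 _∩_

  _∩_ : Sub → Sub → Sub
  U ∩ W = record { Mem = λ x → x ∈ U × x ∈ W ; mem? = λ x → (x ∈? U) ×-dec (x ∈? W) ; mem𝟘 = ∈-𝟘 U , ∈-𝟘 W
                 ; mem⊕ = λ (a , b) (a′ , b′) → ∈-⊕ U a a′ , ∈-⊕ W b b′ ; mem· = λ c (a , b) → ∈-· U c a , ∈-· W c b }

  private
    intro : ∀ W {x y} a → y ⊕ a · x ∈ W → ∃[ i ] (y ⊕ enum i · x ∈ W)
    intro W {x} {y} a h = index a , subst (λ z → y ⊕ z ∈ W) (·-cong x (F.sym (enum-index a))) h

  opaque
    -- The span of `W` and `x` as the union of the translates W - a x. Membership is decided by
    -- trying all q scalars a, and the size is found by counting translates.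
    _⊹_ : Sub → V → Sub
    W ⊹ x = record
      { Mem  = λ y → ∃[ i ] (y ⊕ enum i · x ∈ W)
      ; mem? = λ y → any? λ i → _ ∈? W
      ; mem𝟘 = intro W F.0# (subst (_∈ W) (sym (trans (cong (𝟘 ⊕_) (·-zeroˡ x)) (⊕-identityʳ 𝟘))) (∈-𝟘 W))
      ; mem⊕ = λ (i , h) (j , k) → intro W (enum i F.+ enum j)
          (subst (_∈ W) (trans (⊕-interchange _ _ _ _) (cong (_ ⊕_) (sym (·-distribʳ _ _ x)))) (∈-⊕ W h k))
      ; mem· = λ a (i , h) → intro W (a F.* enum i)
          (subst (_∈ W) (trans (·-distribˡ a _ _) (cong (_ ⊕_) (sym (·-assoc _ _ x)))) (∈-· W a h)) }

    ⊹-intro : ∀ W {x y} a → y ⊕ a · x ∈ W → y ∈ W ⊹ x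
    ⊹-intro W a h = mk∈ (intro W a h)

    ⊹-index : ∀ W {x y} → y ∈ W ⊹ x → ∃[ i ] (y ⊕ enum i · x ∈ W)
    ⊹-index W (mk∈ h) = h

  abstract
    ⊹-elim : ∀ W {x y} → y ∈ W ⊹ x → ∃[ a ] (y ⊕ a · x ∈ W)
    ⊹-elim W h with i , k ← ⊹-index W h = enum i , k

    ⊹-old : ∀ {W x} → W ⊆ W ⊹ x
    ⊹-old {W} {x} {y} h = ⊹-intro W F.0# (subst (_∈ W) (sym (trans (cong (y ⊕_) (·-zeroˡ x)) (⊕-identityʳ y))) h)

    ⊹-new : ∀ {W x} → x ∈ W ⊹ x
    ⊹-new {W} {x} = ⊹-intro W (F.- F.1#) (subst (_∈ W) (sym
      (trans (cong (_⊕ (F.- F.1#) · x) (sym (·-identity x)))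
      (trans (sym (·-distribʳ _ _ x)) (trans (·-cong x (F.-‿inverseʳ F.1#)) (·-zeroˡ x))))) (∈-𝟘 W))

    ⊹-least : ∀ {W U x} → W ⊆ U → x ∈ U → W ⊹ x ⊆ U
    ⊹-least {W} {U} h x∈ y∈ with a , k ← ⊹-elim W y∈ = ∈-⊕⁻ U a x∈ (h k)

    exchange : ∀ {W x y} → y ∈ W ⊹ x → y ∉ W → x ∈ W ⊹ y
    exchange {W} {x} {y} h y∉ with a , k ← ⊹-elim W h | a ≈? F.0#
    ... | yes a≈0 = contradiction (subst (_∈ W) (trans (cong (y ⊕_) (trans (·-cong x a≈0) (·-zeroˡ x))) (⊕-identityʳ y)) k) y∉
    ... | no a≉0 with b , ab≈1 ← F.inverse a a≉0 = ⊹-intro W b (subst (_∈ W) eq (∈-· W b k))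
      where
      eq : b · (y ⊕ a · x) ≡ x ⊕ b · y
      eq = trans (·-distribˡ b y _) (trans (⊕-comm _ _) (cong (_⊕ b · y)
        (trans (sym (·-assoc b a x)) (trans (·-cong x (F.trans (F.*-comm b a) ab≈1)) (·-identity x)))))

  ∣_∣ : Sub → ℕ
  ∣ W ∣ = cnt (_∈? W)

  abstract
    cnt-translate : ∀ W a x → cnt (λ y → (y ⊕ a · x) ∈? W) ≡ ∣ W ∣
    cnt-translate W a x = sym (cnt-inverse (_∈? W) (λ y → y ⊕ a · x) (λ y → y ⊕ (F.- a) · x) (⊕-cancel′ a x) (⊕-cancel a x))

    ∣⊹∣≤ : ∀ W x → ∣ W ⊹ x ∣ ≤ q * ∣ W ∣
    ∣⊹∣≤ W x = ≤-trans (cnt-∃ (_∈? (W ⊹ x)) (λ i y → (y ⊕ enum i · x) ∈? W) (⊹-index W))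
      (≤-reflexive (trans (sum-cong-≗ λ i → cnt-translate W (enum i) x) (sum-const q ∣ W ∣)))

    ⊕-·-minus : ∀ a b x y → (y ⊕ a · x) ⊕ (F.- F.1#) · (y ⊕ b · x) ≡ (a F.+ F.- b) · x
    ⊕-·-minus a b x y = trans (cong ((y ⊕ a · x) ⊕_) (·-distribˡ _ y _)) (trans (⊕-interchange _ _ _ _)
        (trans (cong₂ _⊕_
          (trans (cong (_⊕ (F.- F.1#) · y) (sym (·-identity y))) (trans (sym (·-distribʳ _ _ y)) (trans (·-cong y (F.-‿inverseʳ F.1#)) (·-zeroˡ y))))
          (trans (cong (a · x ⊕_) (trans (sym (·-assoc _ b x)) (·-cong x (RP.-1*x≈-x b)))) (sym (·-distribʳ a _ x))))
        (trans (⊕-comm 𝟘 _) (⊕-identityʳ _))))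

    -- The q translates that make up `W ⊹ x` are disjoint: a common element would put a nonzero
    -- multiple of `x` into `W`.
    ∣⊹∣ : ∀ {W x} → x ∉ W → ∣ W ⊹ x ∣ ≡ q * ∣ W ∣
    ∣⊹∣ {W} {x} x∉ = ≤-antisym (∣⊹∣≤ W x) (≤-trans
      (≤-reflexive (trans (sym (trans (sum-cong-≗ λ i → cnt-translate W (enum i) x) (sum-const q ∣ W ∣)))
                          (∑-comm (λ i y → ⟦ (y ⊕ enum i · x) ∈? W ⟧))))
      (sum-mono each))
      where
      uniq : ∀ {y i j} → y ⊕ enum i · x ∈ W → y ⊕ enum j · x ∈ W → i ≡ j
      uniq {y} {i} {j} h k = enum-inj i j (GP.x∙y⁻¹≈ε⇒x≈y _ _ (decidable-stable (_ ≈? F.0#)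
        λ ne → x∉ (∈-·⁻ W ne (subst (_∈ W) (⊕-·-minus _ _ x y) (∈-⊕ W h (∈-· W (F.- F.1#) k))))))
      each : ∀ y → cnt (λ i → (y ⊕ enum i · x) ∈? W) ≤ ⟦ y ∈? (W ⊹ x) ⟧
      each y with y ∈? (W ⊹ x)
      ... | yes _ = cnt-unique (λ i → (y ⊕ enum i · x) ∈? W) uniq
      ... | no ¬e = ≤-reflexive (cnt-none (λ i → (y ⊕ enum i · x) ∈? W) λ i h → ¬e (⊹-intro W (enum i) h))

    ∣∣-mono : ∀ {U W} → U ⊆ W → ∣ U ∣ ≤ ∣ W ∣
    ∣∣-mono {U} {W} h = cnt-mono (_∈? U) (_∈? W) h

    ⊆-full : ∀ {U W} → U ⊆ W → ∣ W ∣ ≤ ∣ U ∣ → W ⊆ U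
    ⊆-full {U} {W} h le = cnt-⊆-full (_∈? U) (_∈? W) h le

    ∣∅∣ : ∣ ∅ ∣ ≡ 1
    ∣∅∣ = ≤-antisym (cnt-unique (_∈? ∅) λ (mk∈ a) (mk∈ b) → trans a (sym b))
      (≤-trans (≤-reflexive (sym (⟦⟧-true (𝟘 ∈? ∅) (∈-𝟘 ∅)))) (term≤sum (λ x → ⟦ x ∈? ∅ ⟧) 𝟘))

    ∣⊤∣ : ∣ ⊤ ∣ ≡ q ^ d
    ∣⊤∣ = trans (cnt-all (_∈? ⊤) (λ _ → mk∈ refl)) ∣V∣≡

  -- Measuring dimension by cardinality dispenses with bases: nested subspaces of the same dimension
  -- are equal by counting, and adjoining a new vector multiplies the size by q.
  record Dim (W : Sub) (k : ℕ) : Set where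
    constructor mkDim
    field card : ∣ W ∣ ≡ q ^ k
  open Dim public

  abstract
    dim-∅ : Dim ∅ 0
    dim-∅ = mkDim ∣∅∣

    dim-⊤ : Dim ⊤ d
    dim-⊤ = mkDim ∣⊤∣

    dim-⊹ : ∀ {W x k} → Dim W k → x ∉ W → Dim (W ⊹ x) (suc k)
    dim-⊹ dW x∉ = mkDim (trans (∣⊹∣ x∉) (cong (q *_) (card dW)))

    dim-unique-⊆ : ∀ {U W k} → U ⊆ W → Dim U k → Dim W k → W ⊆ U
    dim-unique-⊆ h dU dW = ⊆-full h (≤-reflexive (trans (card dW) (sym (card dU))))

    -- `A` and `v` already span `X`. Most inclusions between lines, planes and solids below are
    -- instances, with a point, a line or a plane as `A`.
    fill : ∀ {A X Y v k} → Dim A k → Dim X (suc k) → A ⊆ X → A ⊆ Y → v ∈ X → v ∈ Y → v ∉ A → X ⊆ Y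
    fill {A} {X} {Y} {v} dA dX AX AY vX vY v∉ h =
      ⊹-least AY vY (dim-unique-⊆ (⊹-least AX vX) (dim-⊹ dA v∉) dX h)

    -- A vector of `W` outside `U` extends `U ∩ W` to a subspace of `W` that is q times as large.
    ∣∩∣-< : ∀ {U W k} → Dim W (suc k) → ¬ (W ⊆ U) → ∣ U ∩ W ∣ ≤ q ^ k
    ∣∩∣-< {U} {W} {k} dW W⊈U with x , xW , x∉U ← ⊈-witness W⊈U =
      *-cancelˡ-≤ q (≤-trans (≤-reflexive (sym (∣⊹∣ {U ∩ W} λ (mk∈ h) → x∉U (proj₁ h))))
        (≤-trans (∣∣-mono (⊹-least {U ∩ W} {W} (λ (mk∈ h) → proj₂ h) xW)) (≤-reflexive (card dW))))

    cnt-∖ : ∀ {U W} → U ⊆ W → cnt (λ x → (x ∈? W) ×-dec ¬? (x ∈? U)) + ∣ U ∣ ≡ ∣ W ∣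
    cnt-∖ {U} {W} h = cnt-⊎-disjoint (λ x → (x ∈? W) ×-dec ¬? (x ∈? U)) (_∈? U) (_∈? W) split (λ z → z) h
      where
      split : ∀ {x} → x ∈ W → (x ∈ W × x ∉ U) ⊎ x ∈ U
      split {x} w with x ∈? U
      ... | yes u = inj₂ u
      ... | no ¬u = inj₁ (w , ¬u)

  Meet : Sub → Sub → Set
  Meet U W = ∃[ v ] (v ∉ ∅ × v ∈ U × v ∈ W)

  abstract
    meet? : ∀ U W → Dec (Meet U W)
    meet? U W = any? λ v → ¬? (v ∈? ∅) ×-dec (v ∈? U) ×-dec (v ∈? W)

  Meet-sym : ∀ {U W} → Meet U W → Meet W U
  Meet-sym (v , n , a , b) = v , n , b , a

-- Lines, flags and families of lines in 5-dimensional space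

module LinesAndFlags (F : Field) (p : ℕ) (size : HasSize F (suc p)) where

  open FiniteCounting
  open Arithmetic
  open VectorSpace F p size 5

  Ind₂ : V → V → Set
  Ind₂ x y = x ∉ ∅ × y ∉ ∅ ⊹ x

  line : V → V → Sub
  line x y = ∅ ⊹ x ⊹ y

  Ind₄ : V → V → V → V → Set
  Ind₄ x y z w = Ind₂ x y × z ∉ line x y × w ∉ line x y ⊹ z

  abstract
    ind₂? : ∀ x y → Dec (Ind₂ x y)
    ind₂? x y = ¬? (x ∈? ∅) ×-dec ¬? (y ∈? (∅ ⊹ x))

    ind₄? : ∀ x y z w → Dec (Ind₄ x y z w)
    ind₄? x y z w = ind₂? x y ×-dec ¬? (z ∈? line x y) ×-dec ¬? (w ∈? (line x y ⊹ z))

  -- Independent x, y, z, w stand for the flag {⟨x,y⟩, ⟨x,y,z,w⟩}; the irrelevant proof makes flags on equal vectors equal.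
  record Flag : Set where
    no-eta-equality
    pattern
    constructor flag
    field
      x y z w : V
      .ind : Ind₄ x y z w
  open Flag public

  ℓ 𝕊 : Flag → Sub
  ℓ P = line (x P) (y P)
  𝕊 P = ℓ P ⊹ z P ⊹ w P

  abstract
    independent : ∀ P → Ind₄ (x P) (y P) (z P) (w P)
    independent (flag x y z w i) = recompute (ind₄? x y z w) i

    dim-line : ∀ {x y} → Ind₂ x y → Dim (line x y) 2
    dim-line (i , j) = dim-⊹ (dim-⊹ dim-∅ i) j

    dim-ℓ : ∀ P → Dim (ℓ P) 2
    dim-ℓ P = dim-line (proj₁ (independent P))

    dim-𝕊 : ∀ P → Dim (𝕊 P) 4
    dim-𝕊 P with _ , k , l ← independent P = dim-⊹ (dim-⊹ (dim-ℓ P) k) l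

    ℓ⊆𝕊 : ∀ P → ℓ P ⊆ 𝕊 P
    ℓ⊆𝕊 P h = ⊹-old (⊹-old h)

    -- A flag consists of four numbered vectors, so flags can be searched exhaustively; this makes
    -- the case distinctions on colour classes constructive.
    ∃-flag? : {A : Flag → Set} → (∀ P → Dec (A P)) → Dec (∃ A)
    ∃-flag? {A} A? = map′ from to (any? λ x → any? λ y → any? λ z → any? λ w → step x y z w (ind₄? x y z w))
      where
      A′ : V → V → V → V → Set
      A′ x y z w = Σ[ i ∈ Ind₄ x y z w ] A (flag x y z w i)
      from : (∃[ x ] ∃[ y ] ∃[ z ] ∃[ w ] A′ x y z w) → ∃ A
      from (x , y , z , w , i , h) = flag x y z w i , h
      to : ∃ A → ∃[ x ] ∃[ y ] ∃[ z ] ∃[ w ] A′ x y z w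
      to (flag x y z w i , h) = x , y , z , w , recompute (ind₄? x y z w) i , h
      step : ∀ x y z w → Dec (Ind₄ x y z w) → Dec (A′ x y z w)
      step x y z w (no ¬i) = no λ (i , _) → ¬i i
      step x y z w (yes i) = map′ (i ,_) proj₂ (A? (flag x y z w i))

  abstract
    ∅-least : ∀ {W} → ∅ ⊆ W
    ∅-least {W} (mk∈ refl) = ∈-𝟘 W

    point-least : ∀ {v W} → v ∈ W → ∅ ⊹ v ⊆ W
    point-least {v} {W} = ⊹-least (∅-least {W})

    line-least : ∀ {x y W} → x ∈ W → y ∈ W → line x y ⊆ W
    line-least {x} {y} {W} a b = ⊹-least (point-least {x} {W} a) b

    x∈line : ∀ {x y} → x ∈ line x y
    x∈line = ⊹-old ⊹-new

    dim-point : ∀ {v} → v ∉ ∅ → Dim (∅ ⊹ v) 1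
    dim-point = dim-⊹ dim-∅

    point-sym : ∀ {u v} → u ∉ ∅ → u ∈ ∅ ⊹ v → v ∈ ∅ ⊹ u
    point-sym u≢ h = exchange h u≢

    -- A line `X` not contained in `Y` meets it in at most one point, so `u` is a multiple of `v`.
    same-point : ∀ {X Y v u W} → Dim X 2 → ¬ (X ⊆ Y) → v ∉ ∅ → v ∈ X → v ∈ Y → u ∈ X → u ∈ Y → v ∈ W → u ∈ W
    same-point {X} {Y} {v} {u} {W} dX X⊈Y v≢ vX vY uX uY vW with u ∈? (∅ ⊹ v)
    ... | yes h = point-least {v} {W} vW h
    ... | no h = contradiction (λ {t} → fill {∅ ⊹ v} {X} {Y} {u} (dim-point v≢) dX (point-least {v} {X} vX) (point-least {v} {Y} vY) uX uY h {t}) X⊈Y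

    -- The disjoint lines `U` and `line x y` span four dimensions, hence all of `X`.
    disjoint⇒same-solid : ∀ {U x y X Y} → Dim U 2 → Ind₂ x y → ¬ Meet U (line x y) → Dim X 4 →
      U ⊆ X → U ⊆ Y → line x y ⊆ X → line x y ⊆ Y → X ⊆ Y
    disjoint⇒same-solid {U} {x} {y} {X} {Y} dU (x≢ , y∉) dis dX UX UY LX LY =
      fill {U ⊹ x} {X} {Y} {y} (dim-⊹ dU λ h → dis (x , x≢ , h , x∈line)) dX
        (⊹-least UX (LX x∈line)) (⊹-least UY (LY x∈line)) (LX ⊹-new) (LY ⊹-new) out
      where
      out : y ∉ U ⊹ x
      out h with a , k ← ⊹-elim U h =
        dis (y ⊕ a · x , (λ n → y∉ (⊹-intro ∅ a n)) , k , ∈-⊕ (line x y) ⊹-new (∈-· (line x y) a x∈line))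

  record Join (U W : Sub) : Set₁ where
    no-eta-equality
    field
      plane  : Sub
      dim₃   : Dim plane 3
      left   : U ⊆ plane
      right  : W ⊆ plane
      minimal : ∀ X → U ⊆ X → W ⊆ X → plane ⊆ X

  abstract
    join : ∀ {U W v} → Dim U 2 → Dim W 2 → v ∉ ∅ → v ∈ U → v ∈ W → ¬ (W ⊆ U) → Join U W
    join {U} {W} {v} dU dW v≢ vU vW W⊈U with u , uW , u∉U ← ⊈-witness W⊈U = record
      { plane = U ⊹ u
      ; dim₃ = dim-⊹ dU u∉U
      ; left = ⊹-old
      ; right = fill {∅ ⊹ v} {W} {U ⊹ u} {u} (dim-point v≢) dW (point-least {v} {W} vW)
          (λ h → ⊹-old (point-least {v} {U} vU h)) uW ⊹-new λ h → u∉U (point-least {v} {U} vU h)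
      ; minimal = λ X UX WX → ⊹-least UX (WX uW) }

    -- The points of `X` on `U` and on `W` are different: a common one would be the intersection `v`
    -- of these lines, which is off `X`. So they span `X`.
    transversal : ∀ {U W v X} (E : Join U W) → Dim U 2 → Dim W 2 → v ∈ U → v ∈ W → ¬ (W ⊆ U) →
      Dim X 2 → Meet X U → Meet X W → v ∉ X → X ⊆ Join.plane E
    transversal {U} {W} {v} {X} E dU dW vU vW W⊈U dX (a , a≢ , aX , aU) (b , b≢ , bX , bW) v∉X =
      fill {∅ ⊹ a} {X} {Join.plane E} {b} (dim-point a≢) dX (point-least {a} {X} aX)
        (point-least {a} {Join.plane E} (Join.left E aU)) bX (Join.right E bW)
        λ h → v∉X (same-point {W} {U} {b} {v} {X} dW W⊈U b≢ bW (point-least {a} {U} aU h) vW vU bX)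

    -- If `x` is not in `S`, then `S` and `x` span V, so some y + a x lies in `S`; independence
    -- keeps it nonzero.
    line-meets-hyperplane : ∀ {S x y} → Dim S 4 → Ind₂ x y → Meet (line x y) S
    line-meets-hyperplane {S} {x} {y} dS (x≢ , y∉) with x ∈? S
    ... | yes h = x , x≢ , x∈line , h
    ... | no h with a , k ← ⊹-elim S (dim-unique-⊆ {S ⊹ x} {⊤} (λ _ → mk∈ refl) (dim-⊹ dS h) dim-⊤ {y} (mk∈ refl)) =
      y ⊕ a · x , (λ n → y∉ (⊹-intro ∅ a n)) , ∈-⊕ (line x y) ⊹-new (∈-· (line x y) a x∈line) , k

  -- A set of at most `k` lines, given by ordered bases: each line has `bases p` of them, by which
  -- `bound` is to be divided.
  record Family (k : ℕ) : Set₁ where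
    no-eta-equality
    field
      Has   : V → V → Set
      has?  : ∀ x y → Dec (Has x y)
      bound : cnt₂ has? ≤ k * bases p
  open Family public

  infixr 5 _∪_

  _∪_ : ∀ {k l} → Family k → Family l → Family (k + l)
  _∪_ {k} {l} A B = record
    { Has = λ x y → Has A x y ⊎ Has B x y
    ; has? = λ x y → has? A x y ⊎-dec has? B x y
    ; bound = ≤-trans (cnt₂-⊎ (λ x y → has? A x y ⊎-dec has? B x y) (has? A) (has? B) λ h → h)
        (≤-trans (+-mono-≤ (bound A) (bound B)) (≤-reflexive (sym (*-distribʳ-+ (bases p) k l)))) }

  weaken : ∀ {k l} → k ≤ l → Family k → Family l
  weaken k≤l A = record { Has = Has A ; has? = has? A ; bound = ≤-trans (bound A) (*-monoˡ-≤ (bases p) k≤l) }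

  private abstract
    summand-≤ : ∀ {a b c e} → a + b ≡ c → c ≤ b + e → a ≤ e
    summand-≤ {a} {b} {c} {e} eq le = +-cancelˡ-≤ b a e (≤-trans (≤-reflexive (trans (+-comm b a) eq)) le)

  Within : Sub → V → V → Set
  Within W x y = (x ∈ W × x ∉ ∅) × (y ∈ W × y ∉ ∅ ⊹ x)

  within? : ∀ W x y → Dec (Within W x y)
  within? W x y = ((x ∈? W) ×-dec ¬? (x ∈? ∅)) ×-dec ((y ∈? W) ×-dec ¬? (y ∈? (∅ ⊹ x)))

  abstract
    within-intro : ∀ {W x y} → Ind₂ x y → line x y ⊆ W → Within W x y
    within-intro (i , j) h = (h x∈line , i) , (h ⊹-new , j)

    cnt-∖∅ : ∀ W {a} → ∣ W ∣ ≤ 1 + a → cnt (λ x → (x ∈? W) ×-dec ¬? (x ∈? ∅)) ≤ a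
    cnt-∖∅ W wa = summand-≤ (cnt-∖ {∅} {W} ∅-least) (≤-trans wa (+-monoˡ-≤ _ (≤-reflexive (sym ∣∅∣))))

    ∣point∣ : ∀ {x} → x ∉ ∅ → ∣ ∅ ⊹ x ∣ ≡ q
    ∣point∣ x≢ = trans (card (dim-point x≢)) (*-identityʳ q)

    cnt-∖point : ∀ W {x b} → x ∉ ∅ → x ∈ W → ∣ W ∣ ≤ q + b → cnt (λ y → (y ∈? W) ×-dec ¬? (y ∈? (∅ ⊹ x))) ≤ b
    cnt-∖point W {x} x≢ xW wb = summand-≤ (cnt-∖ {∅ ⊹ x} {W} (point-least {x} {W} xW))
      (≤-trans wb (+-monoˡ-≤ _ (≤-reflexive (sym (∣point∣ x≢)))))

    cnt-within : ∀ W {a b} → ∣ W ∣ ≤ 1 + a → ∣ W ∣ ≤ q + b → cnt₂ (within? W) ≤ a * b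
    cnt-within W wa wb = cnt₂-×-≤ (within? W) (λ x → (x ∈? W) ×-dec ¬? (x ∈? ∅)) (λ x y → (y ∈? W) ×-dec ¬? (y ∈? (∅ ⊹ x)))
      (λ h → h) (cnt-∖∅ W wa) (λ (xW , x≢) → cnt-∖point W x≢ xW wb)

  -- Bases x, y of the lines inside W that meet U but are not contained in S, where U ⊆ S ⊆ W.
  Meeting : Sub → Sub → Sub → V → V → Set
  Meeting W S U x y = ((x ∈ U × x ∉ ∅) × (y ∈ W × y ∉ S)) ⊎ ((x ∈ W × x ∉ S) × (y ∈ U ⊹ x × y ∉ ∅ ⊹ x))

  meeting? : ∀ W S U x y → Dec (Meeting W S U x y)
  meeting? W S U x y = (((x ∈? U) ×-dec ¬? (x ∈? ∅)) ×-dec ((y ∈? W) ×-dec ¬? (y ∈? S)))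
    ⊎-dec (((x ∈? W) ×-dec ¬? (x ∈? S)) ×-dec ((y ∈? (U ⊹ x)) ×-dec ¬? (y ∈? (∅ ⊹ x))))

  abstract
    meeting-intro : ∀ {W S U x y} → Ind₂ x y → U ⊆ S → line x y ⊆ W → Meet (line x y) U → ¬ (line x y ⊆ S) → Meeting W S U x y
    meeting-intro {W} {S} {U} {x} {y} (x≢ , y∉) US LW (v , v≢ , vL , vU) L⊈S with x ∈? U
    ... | yes xU = inj₁ ((xU , x≢) , LW ⊹-new , λ yS → L⊈S (line-least {x} {y} {S} (US xU) yS))
    ... | no x∉U = inj₂ ((LW x∈line , λ xS → L⊈S (line-least {x} {y} {S} xS
                           (⊹-least (point-least {x} {S} xS) (US vU) y∈)))
                        , ⊹-least (point-least {x} {U ⊹ x} ⊹-new) (⊹-old vU) y∈ , y∉)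
      where
      y∈ : y ∈ ∅ ⊹ x ⊹ v
      y∈ = exchange vL λ v∈ → x∉U (point-least {v} {U} vU (point-sym v≢ v∈))

    cnt-meeting : ∀ W S U {u e f} → U ⊆ S → S ⊆ W → ∣ U ∣ ≤ 1 + u → ∣ W ∣ ≤ ∣ S ∣ + e → q * ∣ U ∣ ≤ q + f →
                  cnt₂ (meeting? W S U) ≤ u * e + e * f
    cnt-meeting W S U {u} {e} {f} US SW Uu We Uf = ≤-trans
      (cnt₂-⊎ (meeting? W S U)
        (λ x y → ((x ∈? U) ×-dec ¬? (x ∈? ∅)) ×-dec ((y ∈? W) ×-dec ¬? (y ∈? S)))
        (λ x y → ((x ∈? W) ×-dec ¬? (x ∈? S)) ×-dec ((y ∈? (U ⊹ x)) ×-dec ¬? (y ∈? (∅ ⊹ x)))) (λ h → h))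
      (+-mono-≤
        (cnt₂-×-≤ _ (λ x → (x ∈? U) ×-dec ¬? (x ∈? ∅)) (λ x y → (y ∈? W) ×-dec ¬? (y ∈? S))
          (λ h → h) (cnt-∖∅ U Uu) (λ _ → outside))
        (cnt₂-×-≤ _ (λ x → (x ∈? W) ×-dec ¬? (x ∈? S)) (λ x y → (y ∈? (U ⊹ x)) ×-dec ¬? (y ∈? (∅ ⊹ x)))
          (λ h → h) outside λ {x} (_ , x∉S) → cnt-∖point (U ⊹ x) (λ h → x∉S (∅-least {S} h)) ⊹-new
            (≤-trans (≤-reflexive (∣⊹∣ {U} λ h → x∉S (US h))) Uf)))
      where
      outside : cnt (λ x → (x ∈? W) ×-dec ¬? (x ∈? S)) ≤ e
      outside = summand-≤ (cnt-∖ {S} {W} SW) We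

    lineFamily : ∀ W → ∣ W ∣ ≤ q ^ 2 → Family 1
    lineFamily W h = record
      { Has = Within W ; has? = within? W
      ; bound = ≤-trans (cnt-within W (≤-trans h (≤-reflexive (q²-1 p))) (≤-trans h (≤-reflexive (q²-q p))))
                        (≤-reflexive (lines-in-line p)) }

    lineFamily-∋ : ∀ {W h x y} → Ind₂ x y → line x y ⊆ W → Has (lineFamily W h) x y
    lineFamily-∋ {W} = within-intro {W}

    planeFamily : ∀ W → ∣ W ∣ ≤ q ^ 3 → Family (θ₂ q)
    planeFamily W h = record
      { Has = Within W ; has? = within? W
      ; bound = ≤-trans (cnt-within W (≤-trans h (≤-reflexive (q³-1 p))) (≤-trans h (≤-reflexive (q³-q p))))
                        (≤-reflexive (lines-in-plane p)) }

    planeFamily-∋ : ∀ {W h x y} → Ind₂ x y → line x y ⊆ W → Has (planeFamily W h) x y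
    planeFamily-∋ {W} = within-intro {W}

    solidFamily : ∀ W → ∣ W ∣ ≤ q ^ 4 → Family (solidLines q)
    solidFamily W h = record
      { Has = Within W ; has? = within? W
      ; bound = ≤-trans (cnt-within W (≤-trans h (≤-reflexive (q⁴-1 p))) (≤-trans h (≤-reflexive (q⁴-q p))))
                        (≤-reflexive (lines-in-solid p)) }

    solidFamily-∋ : ∀ {W h x y} → Ind₂ x y → line x y ⊆ W → Has (solidFamily W h) x y
    solidFamily-∋ {W} = within-intro {W}

    -- The lines of `W` on the point ⟨v⟩, as the case U = S = ⟨v⟩ of `Meeting`. Each of them has q p
    -- vectors off this point, so `k` bounds their number.
    starFamily : ∀ k W v → v ∉ ∅ → v ∈ W → ∣ W ∣ ≤ q + q * (p * k) → Family k
    starFamily k W v v≢ vW h = record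
      { Has = Meeting W (∅ ⊹ v) (∅ ⊹ v) ; has? = meeting? W (∅ ⊹ v) (∅ ⊹ v)
      ; bound = ≤-trans
          (cnt-meeting W (∅ ⊹ v) (∅ ⊹ v) (λ z → z) (point-least {v} {W} vW) (≤-reflexive (∣point∣ v≢))
            (≤-trans h (+-monoˡ-≤ _ (≤-reflexive (sym (∣point∣ v≢)))))
            (≤-reflexive (trans (cong (q *_) (trans (∣point∣ v≢) (sym (*-identityʳ q)))) (q²-q p))))
          (≤-reflexive (lines-on-point p k)) }

    star-intro : ∀ {W v x y} → v ∉ ∅ → Ind₂ x y → line x y ⊆ W → v ∈ line x y → Meeting W (∅ ⊹ v) (∅ ⊹ v) x y
    star-intro {W} {v} {x} {y} v≢ (x≢ , y∉) LW v∈ = meeting-intro {W} {∅ ⊹ v} {∅ ⊹ v} (x≢ , y∉) (λ z → z) LW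
      (v , v≢ , v∈ , ⊹-new)
      λ h → y∉ (point-least {v} {∅ ⊹ x} (point-sym x≢ (h x∈line)) (h ⊹-new))

    star : ∀ v → v ∉ ∅ → Family (θ₃ q)
    star v v≢ = starFamily (θ₃ q) ⊤ v v≢ (mk∈ refl)
      (≤-reflexive (trans ∣⊤∣ (trans (q⁵-q p) (cong (q +_) (lemma (θ₃ q) p)))))
      where
      lemma : ∀ a p → a * (p * suc p) ≡ suc p * (p * a)
      lemma a p = trans (*-comm a _) (trans (cong (_* a) (*-comm p (suc p))) (*-assoc (suc p) p a))

    star-∋ : ∀ {v v≢ x y} → Ind₂ x y → v ∈ line x y → Has (star v v≢) x y
    star-∋ {v} {v≢} i h = star-intro {⊤} v≢ i (λ _ → mk∈ refl) h

    starInPlane : ∀ W v → v ∉ ∅ → v ∈ W → Dim W 3 → Family (q + 1)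
    starInPlane W v v≢ vW dW = starFamily (q + 1) W v v≢ vW (≤-reflexive (trans (card dW) (q³-q p)))

    starInPlane-∋ : ∀ {W v v≢ vW dW x y} → Ind₂ x y → line x y ⊆ W → v ∈ line x y → Has (starInPlane W v v≢ vW dW) x y
    starInPlane-∋ {W} {v} {v≢} i LW h = star-intro {W} v≢ i LW h

    starInSolid : ∀ W v → v ∉ ∅ → v ∈ W → Dim W 4 → Family (θ₂ q)
    starInSolid W v v≢ vW dW = starFamily (θ₂ q) W v v≢ vW (≤-reflexive (trans (card dW) (q⁴-q p)))

    starInSolid-∋ : ∀ {W v v≢ vW dW x y} → Ind₂ x y → line x y ⊆ W → v ∈ line x y → Has (starInSolid W v v≢ vW dW) x y
    starInSolid-∋ {W} {v} {v≢} i LW h = star-intro {W} v≢ i LW h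

    meetingOutside : ∀ U S → Dim U 2 → Dim S 4 → U ⊆ S → Family (transversals q)
    meetingOutside U S dU dS US = record
      { Has = Meeting ⊤ S U ; has? = meeting? ⊤ S U
      ; bound = ≤-trans
          (cnt-meeting ⊤ S U US (λ _ → mk∈ refl)
            (≤-reflexive (trans (card dU) (q²-1 p)))
            (≤-reflexive (trans ∣⊤∣ (trans (q⁵-q⁴ p) (cong (_+ p * q ^ 4) (sym (card dS))))))
            (≤-reflexive (trans (cong (q *_) (card dU)) (q³-q p))))
          (≤-reflexive (lines-meeting p)) }

    meetingOutside-∋ : ∀ {U S dU dS x y} (US : U ⊆ S) → Ind₂ x y → Meet (line x y) U → ¬ (line x y ⊆ S) →
      Has (meetingOutside U S dU dS US) x y
    meetingOutside-∋ {U} {S} US i m o = meeting-intro {⊤} {S} {U} i US (λ _ → mk∈ refl) m o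

-- Classification of the colour classes outside all point-pencils

module ColourClasses (F : Field) (r : ℕ) (size : HasSize F (3 + r)) where

  open FiniteCounting
  open Arithmetic
  open VectorSpace F (2 + r) size 5
  open LinesAndFlags F (2 + r) size

  _∋_ : ∀ {k} → Family k → Flag → Set
  A ∋ P = Has A (x P) (y P)

  module Coclique (C : Flag → Set) (C? : ∀ P → Dec (C P))
    (nonadjacent : ∀ {P Q} → C P → C Q → Meet (ℓ P) (ℓ Q) ⊎ (ℓ P ⊆ 𝕊 Q ⊎ ℓ Q ⊆ 𝕊 P)) where

    Heavy : Flag → Set
    Heavy P = C P × ∃[ Q ] (C Q × ℓ Q ⊆ ℓ P × ¬ (𝕊 Q ⊆ 𝕊 P))

    heavy? : ∀ P → Dec (Heavy P)
    heavy? P = C? P ×-dec ∃-flag? λ Q → C? Q ×-dec (ℓ Q ⊆? ℓ P) ×-dec ¬? (𝕊 Q ⊆? 𝕊 P)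

    -- Bounding families replace exact numbers of heavy and light lines. Every heavy line is in `Φ`,
    -- so a line of the class that is only in `Λ` is light and carries one flag.
    record Cover : Set₁ where
      no-eta-equality
      field
        φ l    : ℕ
        small  : Small q φ l
        Φ      : Family φ
        Λ      : Family l
        heavy  : ∀ P → Heavy P → Φ ∋ P
        covers : ∀ P → C P → (Φ ∋ P) ⊎ (Λ ∋ P)

    abstract
      ℓ-⊇ : ∀ {P Q} → ℓ Q ⊆ ℓ P → ℓ P ⊆ ℓ Q
      ℓ-⊇ {P} {Q} h = dim-unique-⊆ h (dim-ℓ Q) (dim-ℓ P)

      𝕊-⊇ : ∀ {P Q} → 𝕊 Q ⊆ 𝕊 P → 𝕊 P ⊆ 𝕊 Q
      𝕊-⊇ {P} {Q} h = dim-unique-⊆ h (dim-𝕊 Q) (dim-𝕊 P)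

      ind₂ : ∀ P → Ind₂ (x P) (y P)
      ind₂ P = proj₁ (independent P)

      ∣𝕊∣ : ∀ P → ∣ 𝕊 P ∣ ≤ q ^ 4
      ∣𝕊∣ P = ≤-reflexive (card (dim-𝕊 P))

      same-solid : ∀ {P Q X Y} → ¬ Meet (ℓ P) (ℓ Q) → Dim X 4 → ℓ P ⊆ X → ℓ P ⊆ Y → ℓ Q ⊆ X → ℓ Q ⊆ Y → X ⊆ Y
      same-solid {P} {Q} {X} {Y} = disjoint⇒same-solid {ℓ P} {x Q} {y Q} {X} {Y} (dim-ℓ P) (ind₂ Q)

      -- If `ℓ P` were not in `𝕊 Q`, then `ℓ Q` would lie in two different solids that the class has
      -- on `ℓ P`; but two disjoint lines lie in only one common solid.
      heavy⊆ : ∀ {P Q} → Heavy P → C Q → ¬ Meet (ℓ P) (ℓ Q) → ℓ P ⊆ 𝕊 Q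
      heavy⊆ {P} {Q} (cP , R , cR , RP , R⊈P) cQ dis with nonadjacent cP cQ
      ... | inj₁ m = contradiction m dis
      ... | inj₂ (inj₁ h) = h
      ... | inj₂ (inj₂ QP) with nonadjacent cR cQ
      ... | inj₁ (v , v≢ , vR , vQ) = contradiction (v , v≢ , RP vR , vQ) dis
      ... | inj₂ (inj₁ h) = λ t → h (ℓ-⊇ {P} {R} RP t)
      ... | inj₂ (inj₂ QR) = contradiction
        (λ {t} → same-solid {P} {Q} {𝕊 R} {𝕊 P} dis (dim-𝕊 R) (λ t → ℓ⊆𝕊 R (ℓ-⊇ {P} {R} RP t)) (ℓ⊆𝕊 P) QR QP {t}) R⊈P

      -- If the lines were disjoint, `ℓ P` would lie in two different solids of the class on `ℓ Q`,
      -- both spanned by the two lines.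
      heavy-meet : ∀ {P Q} → Heavy P → Heavy Q → Meet (ℓ P) (ℓ Q)
      heavy-meet {P} {Q} hP hQ@(cQ , R , cR , RQ , R⊈Q) with meet? (ℓ P) (ℓ Q)
      ... | yes m = m
      ... | no dis = contradiction
        (λ {t} → same-solid {P} {Q} {𝕊 R} {𝕊 Q} dis (dim-𝕊 R)
          (heavy⊆ {P} {R} hP cR λ (v , v≢ , vP , vR) → dis (v , v≢ , vP , RQ vR)) (heavy⊆ {P} {Q} hP cQ dis)
          (λ t → ℓ⊆𝕊 R (ℓ-⊇ {Q} {R} RQ t)) (ℓ⊆𝕊 Q) {t}) R⊈Q

    -- `P₀` carries the only heavy line, or is any flag of the class if there is none. Lines in
    -- `𝕊 P₀` and lines meeting `ℓ P₀` are counted outright. The remaining flags, called `Other`,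
    -- have solids containing `ℓ P₀`; their lines are confined to a star and a plane unless the
    -- whole class lives in one solid.
    module OneHeavyLine (P₀ : Flag) (c₀ : C P₀) (only : ∀ P → Heavy P → ℓ P ⊆ ℓ P₀) where

      Φ₀ : Family 1
      Φ₀ = lineFamily (ℓ P₀) (≤-reflexive (card (dim-ℓ P₀)))

      Other : Flag → Set
      Other P = C P × ¬ Meet (ℓ P) (ℓ P₀) × ¬ (ℓ P ⊆ 𝕊 P₀)

      other? : ∀ P → Dec (Other P)
      other? P = C? P ×-dec ¬? (meet? (ℓ P) (ℓ P₀)) ×-dec ¬? (ℓ P ⊆? 𝕊 P₀)

      abstract
        other⊇ : ∀ {P} → Other P → ℓ P₀ ⊆ 𝕊 P
        other⊇ (cP , dis , out) with nonadjacent cP c₀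
        ... | inj₁ m = contradiction m dis
        ... | inj₂ (inj₁ h) = contradiction (λ {t} → h {t}) out
        ... | inj₂ (inj₂ h) = h

      cover-others : (Λ : Family (θ₃ q + θ₂ q)) → (∀ P → Other P → Λ ∋ P) → Cover
      cover-others Λ h = record
        { small = small₁ r ; Φ = Φ₀
        ; Λ = solidFamily (𝕊 P₀) (∣𝕊∣ P₀) ∪ (meetingOutside (ℓ P₀) (𝕊 P₀) (dim-ℓ P₀) (dim-𝕊 P₀) (ℓ⊆𝕊 P₀) ∪ Λ)
        ; heavy = λ P hP → lineFamily-∋ {ℓ P₀} (ind₂ P) (only P hP)
        ; covers = λ P cP → inj₂ (covers P cP (ℓ P ⊆? 𝕊 P₀) (meet? (ℓ P) (ℓ P₀))) }
        where
        covers : ∀ P → C P → Dec (ℓ P ⊆ 𝕊 P₀) → Dec (Meet (ℓ P) (ℓ P₀)) →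
          (solidFamily (𝕊 P₀) (∣𝕊∣ P₀) ∪ (meetingOutside (ℓ P₀) (𝕊 P₀) (dim-ℓ P₀) (dim-𝕊 P₀) (ℓ⊆𝕊 P₀) ∪ Λ)) ∋ P
        covers P cP (yes i) _ = inj₁ (solidFamily-∋ {𝕊 P₀} (ind₂ P) i)
        covers P cP (no o) (yes m) = inj₂ (inj₁
          (meetingOutside-∋ {ℓ P₀} {𝕊 P₀} (ℓ⊆𝕊 P₀) (ind₂ P) m o))
        covers P cP (no o) (no d) = inj₂ (inj₂ (h P (cP , d , o)))

      one-solid : ∀ P₁ → (∀ P → C P → ℓ P ⊆ 𝕊 P₁) → Cover
      one-solid P₁ h = record
        { small = small₁ r ; Φ = Φ₀ ; Λ = weaken (m≤m+n _ _) (solidFamily (𝕊 P₁) (∣𝕊∣ P₁))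
        ; heavy = λ P hP → lineFamily-∋ {ℓ P₀} (ind₂ P) (only P hP)
        ; covers = λ P cP → inj₂ (solidFamily-∋ {𝕊 P₁} (ind₂ P) (h P cP)) }

      abstract
        -- Both solids contain `ℓ P₀`. If `ℓ P` lay in `𝕊 Q`, then `𝕊 P` and `𝕊 Q` would both be the
        -- span of `ℓ P` and `ℓ P₀`; likewise with `P` and `Q` exchanged.
        others-meet : ∀ {P Q} → Other P → Other Q → ¬ (𝕊 Q ⊆ 𝕊 P) → Meet (ℓ P) (ℓ Q)
        others-meet {P} {Q} oP@(cP , disP , _) oQ@(cQ , disQ , _) Q⊈P with nonadjacent cP cQ
        ... | inj₁ m = m
        ... | inj₂ (inj₁ h) = contradiction
          (λ {t} → same-solid {P} {P₀} {𝕊 Q} {𝕊 P} disP (dim-𝕊 Q) h (ℓ⊆𝕊 P) (other⊇ {Q} oQ) (other⊇ {P} oP) {t}) Q⊈P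
        ... | inj₂ (inj₂ h) = contradiction
          (λ {t} → same-solid {Q} {P₀} {𝕊 Q} {𝕊 P} disQ (dim-𝕊 Q) (ℓ⊆𝕊 Q) h (other⊇ {Q} oQ) (other⊇ {P} oP) {t}) Q⊈P

      -- The lines of all `Other` flags pass through `v` or lie in the plane of `ℓ P₁` and `ℓ P₂`.
      -- If the solid is `𝕊 P₁`, the line meets `ℓ P₂`, whose only point in `𝕊 P₁` is `v`;
      -- symmetrically for `𝕊 P₂`. With any other solid the line meets both lines, and `transversal`
      -- applies.
      module TwoSolids {P₁ P₂ : Flag} (o₁ : Other P₁) (o₂ : Other P₂) (2⊈1 : ¬ (𝕊 P₂ ⊆ 𝕊 P₁))
        {v : V} (v≢ : v ∉ ∅) (v1 : v ∈ ℓ P₁) (v2 : v ∈ ℓ P₂) where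
        abstract
          ℓ2⊈ : ¬ (ℓ P₂ ⊆ 𝕊 P₁)
          ℓ2⊈ h = 2⊈1 λ {t} → same-solid {P₂} {P₀} {𝕊 P₂} {𝕊 P₁} (proj₁ (proj₂ o₂)) (dim-𝕊 P₂) (ℓ⊆𝕊 P₂) h (other⊇ {P₂} o₂) (other⊇ {P₁} o₁) {t}
          ℓ1⊈ : ¬ (ℓ P₁ ⊆ 𝕊 P₂)
          ℓ1⊈ h = 2⊈1 (𝕊-⊇ {P₂} {P₁} λ {t} → same-solid {P₁} {P₀} {𝕊 P₁} {𝕊 P₂} (proj₁ (proj₂ o₁)) (dim-𝕊 P₁) (ℓ⊆𝕊 P₁) h (other⊇ {P₁} o₁) (other⊇ {P₂} o₂) {t})
          ℓ2⊈ℓ1 : ¬ (ℓ P₂ ⊆ ℓ P₁)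
          ℓ2⊈ℓ1 h = ℓ2⊈ λ t → ℓ⊆𝕊 P₁ (h t)
          J : Join (ℓ P₁) (ℓ P₂)
          J = join (dim-ℓ P₁) (dim-ℓ P₂) v≢ v1 v2 ℓ2⊈ℓ1

        E : Sub
        E = Join.plane J
        Λ₀ : Family (θ₃ q + θ₂ q)
        Λ₀ = star v v≢ ∪ planeFamily E (≤-reflexive (card (Join.dim₃ J)))
        cover : ∀ P → Other P → Dec (𝕊 P₁ ⊆ 𝕊 P) → Dec (𝕊 P₂ ⊆ 𝕊 P) → Dec (v ∈ ℓ P) →
                Λ₀ ∋ P
        cover P oP _ _ (yes v∈) = inj₁ (star-∋ (ind₂ P) v∈)
        cover P oP (yes 1P) _ (no v∉) with others-meet {P} {P₂} oP o₂ (λ 2P → 2⊈1 λ t → 𝕊-⊇ {P} {P₁} 1P (2P t))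
        ... | u , u≢ , uP , u2 = contradiction
          (same-point {ℓ P₂} {𝕊 P₁} {u} {v} {ℓ P} (dim-ℓ P₂) ℓ2⊈ u≢ u2 (𝕊-⊇ {P} {P₁} 1P (ℓ⊆𝕊 P uP)) v2 (ℓ⊆𝕊 P₁ v1) uP) v∉
        cover P oP (no 1⊈P) (yes 2P) (no v∉) with others-meet {P} {P₁} oP o₁ 1⊈P
        ... | u , u≢ , uP , u1 = contradiction
          (same-point {ℓ P₁} {𝕊 P₂} {u} {v} {ℓ P} (dim-ℓ P₁) ℓ1⊈ u≢ u1 (𝕊-⊇ {P} {P₂} 2P (ℓ⊆𝕊 P uP)) v1 (ℓ⊆𝕊 P₂ v2) uP) v∉
        cover P oP (no 1⊈P) (no 2⊈P) (no v∉) = inj₂ (planeFamily-∋ {E} (ind₂ P)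
          (transversal {ℓ P₁} {ℓ P₂} {v} {ℓ P} J (dim-ℓ P₁) (dim-ℓ P₂) v1 v2 ℓ2⊈ℓ1 (dim-ℓ P)
            (others-meet {P} {P₁} oP o₁ 1⊈P) (others-meet {P} {P₂} oP o₂ 2⊈P) v∉))
        result : Cover
        result = cover-others Λ₀ λ P oP → cover P oP (𝕊 P₁ ⊆? 𝕊 P) (𝕊 P₂ ⊆? 𝕊 P) (v ∈? ℓ P)

      -- All `Other` lines lie in `𝕊 P₁`, which `ℓ Q` meets in a single point `v`. So such a line
      -- passes through `v` or lies in `𝕊 P₁ ∩ 𝕊 Q`, at most a plane.
      outside-solid : ∀ {P₁ Q} → (∀ P → Other P → 𝕊 P ⊆ 𝕊 P₁) → C Q → ¬ (ℓ Q ⊆ 𝕊 P₁) → Cover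
      outside-solid {P₁} {Q} one cQ Q⊈ with line-meets-hyperplane {𝕊 P₁} (dim-𝕊 P₁) (ind₂ Q)
      ... | v , v≢ , vQ , v1 = cover-others (star v v≢ ∪ planeFamily (𝕊 P₁ ∩ 𝕊 Q) small)
          λ P oP → cover P oP (nonadjacent (proj₁ oP) cQ)
        where
        small : ∣ 𝕊 P₁ ∩ 𝕊 Q ∣ ≤ q ^ 3
        small = ∣∩∣-< {𝕊 P₁} {𝕊 Q} (dim-𝕊 Q) λ h → Q⊈ λ t → h (ℓ⊆𝕊 Q t)
        cover : ∀ P → Other P → Meet (ℓ P) (ℓ Q) ⊎ (ℓ P ⊆ 𝕊 Q ⊎ ℓ Q ⊆ 𝕊 P) →
                (star v v≢ ∪ planeFamily (𝕊 P₁ ∩ 𝕊 Q) small) ∋ P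
        cover P oP (inj₁ (u , u≢ , uP , uQ)) = inj₁ (star-∋ (ind₂ P)
          (same-point {ℓ Q} {𝕊 P₁} {u} {v} {ℓ P} (dim-ℓ Q) Q⊈ u≢ uQ (one P oP (ℓ⊆𝕊 P uP)) vQ v1 uP))
        cover P oP (inj₂ (inj₁ h)) = inj₂ (planeFamily-∋ {𝕊 P₁ ∩ 𝕊 Q} (ind₂ P) λ t → mk∈ (one P oP (ℓ⊆𝕊 P t) , h t))
        cover P oP (inj₂ (inj₂ h)) = contradiction (λ {t} z → one P oP (h {t} z)) Q⊈

      cover : Cover
      cover with ∃-flag? other?
      -- Without `Other` flags any family of the right size will do.
      ... | no none = cover-others (weaken (m≤m+n _ _) (star (x P₀) (proj₁ (ind₂ P₀))))
                                   λ P oP → contradiction (P , oP) none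
      ... | yes (P₁ , o₁) with ∃-flag? (λ P → other? P ×-dec ¬? (𝕊 P ⊆? 𝕊 P₁))
      ... | yes (P₂ , o₂ , 2⊈1) with others-meet {P₁} {P₂} o₁ o₂ 2⊈1
      ... | v , v≢ , v1 , v2 = TwoSolids.result {P₁} {P₂} o₁ o₂ 2⊈1 v≢ v1 v2
      cover | yes (P₁ , o₁) | no none with ∃-flag? (λ P → C? P ×-dec ¬? (ℓ P ⊆? 𝕊 P₁))
      ... | yes (Q , cQ , Q⊈) = outside-solid {P₁} {Q}
        (λ P oP → decidable-stable (𝕊 P ⊆? 𝕊 P₁) λ o → none (P , oP , o)) cQ Q⊈
      ... | no none′ = one-solid P₁ λ P cP → decidable-stable (ℓ P ⊆? 𝕊 P₁) λ o → none′ (P , cP , o)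

    -- Flags whose solids contain π but whose lines do not lie in π: either there is only one solid, or all lines share a point of π.
    module Bundle (π : Sub) (dπ : Dim π 3) (A : Flag → Set) (A? : ∀ P → Dec (A P))
      (A⇒C : ∀ {P} → A P → C P) (A⇒π : ∀ {P} → A P → π ⊆ 𝕊 P) (A⇒⊈ : ∀ {P} → A P → ¬ (ℓ P ⊆ π)) where

      abstract
        -- If the line of one flag lay in the solid of the other, the two solids would share `π` and
        -- a point outside it, and so coincide.
        bundle-meet : ∀ {P Q} → A P → A Q → ¬ (𝕊 P ⊆ 𝕊 Q) → Meet (ℓ P) (ℓ Q)
        bundle-meet {P} {Q} aP aQ P⊈Q with nonadjacent (A⇒C aP) (A⇒C aQ)
        ... | inj₁ m = m
        ... | inj₂ (inj₁ h) with v , vP , v∉ ← ⊈-witness {ℓ P} {π} (A⇒⊈ {P} aP) = contradiction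
          (λ {t} → fill {π} {𝕊 P} {𝕊 Q} {v} dπ (dim-𝕊 P) (A⇒π {P} aP) (A⇒π {Q} aQ) (ℓ⊆𝕊 P vP) (h vP) v∉ {t}) P⊈Q
        ... | inj₂ (inj₂ h) with v , vQ , v∉ ← ⊈-witness {ℓ Q} {π} (A⇒⊈ {Q} aQ) = contradiction
          (λ {t} → fill {π} {𝕊 P} {𝕊 Q} {v} dπ (dim-𝕊 P) (A⇒π {P} aP) (A⇒π {Q} aQ) (h vQ) (ℓ⊆𝕊 Q vQ) v∉ {t}) P⊈Q

        axis : ∀ {P Q v} → A P → A Q → ¬ (𝕊 P ⊆ 𝕊 Q) → v ∈ 𝕊 P → v ∈ 𝕊 Q → v ∈ π
        axis {P} {Q} {v} aP aQ P⊈Q vP vQ = decidable-stable (v ∈? π) λ v∉ →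
          P⊈Q λ {t} → fill {π} {𝕊 P} {𝕊 Q} {v} dπ (dim-𝕊 P) (A⇒π {P} aP) (A⇒π {Q} aQ) vP vQ v∉ {t}

      family : ∀ v → v ∉ ∅ → Σ[ B ∈ Family (solidLines q) ] (∀ P → A P → B ∋ P)
      family o o≢ with ∃-flag? A?
      ... | no none = weaken (≤-trans (m≤m+n _ _) (star+plane≤solid r)) (star o o≢) , λ P aP → contradiction (P , aP) none
      ... | yes (P₁ , a₁) with ∃-flag? (λ P → A? P ×-dec ¬? (𝕊 P ⊆? 𝕊 P₁))
      ... | no none = solidFamily (𝕊 P₁) (∣𝕊∣ P₁) , λ P aP → solidFamily-∋ {𝕊 P₁} (ind₂ P)
        λ t → decidable-stable (𝕊 P ⊆? 𝕊 P₁) (λ o → none (P , aP , o)) (ℓ⊆𝕊 P t)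
      ... | yes (P₂ , a₂ , 2⊈1) with bundle-meet {P₂} {P₁} a₂ a₁ 2⊈1
      ... | v , v≢ , v2 , v1 = weaken (≤-trans (m≤m+n _ _) (star+plane≤solid r)) (star v v≢) , λ P aP → star-∋ (ind₂ P) (on P aP (𝕊 P ⊆? 𝕊 P₁))
        where
        vπ : v ∈ π
        vπ = axis {P₂} {P₁} a₂ a₁ 2⊈1 (ℓ⊆𝕊 P₂ v2) (ℓ⊆𝕊 P₁ v1)
        -- `ℓ P₁` and `ℓ P₂` meet `π` only in `v`. The solid of `P` differs from that of `P₁` or
        -- from that of `P₂`, and lines of flags with different solids meet in a point of `π`.
        on : ∀ P → A P → Dec (𝕊 P ⊆ 𝕊 P₁) → v ∈ ℓ P
        on P aP (no P⊈1) with bundle-meet {P} {P₁} aP a₁ P⊈1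
        ... | u , u≢ , uP , u1 = same-point {ℓ P₁} {π} {u} {v} {ℓ P} (dim-ℓ P₁) (A⇒⊈ {P₁} a₁) u≢ u1
          (axis {P} {P₁} aP a₁ P⊈1 (ℓ⊆𝕊 P uP) (ℓ⊆𝕊 P₁ u1)) v1 vπ uP
        on P aP (yes P1) with bundle-meet {P₂} {P} a₂ aP (λ 2P → 2⊈1 λ t → P1 (2P t))
        ... | u , u≢ , u2 , uP = same-point {ℓ P₂} {π} {u} {v} {ℓ P} (dim-ℓ P₂) (A⇒⊈ {P₂} a₂) u≢ u2
          (axis {P₂} {P} a₂ aP (λ 2P → 2⊈1 λ t → P1 (2P t)) (ℓ⊆𝕊 P₂ u2) (ℓ⊆𝕊 P uP)) v2 vπ uP

    module TwoHeavyLines (P₁ P₂ : Flag) (h₁ : Heavy P₁) (h₂ : Heavy P₂) (2⊈1 : ¬ (ℓ P₂ ⊆ ℓ P₁))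
      (v : V) (v≢ : v ∉ ∅) (v1 : v ∈ ℓ P₁) (v2 : v ∈ ℓ P₂) where

      abstract
        J : Join (ℓ P₁) (ℓ P₂)
        J = join (dim-ℓ P₁) (dim-ℓ P₂) v≢ v1 v2 2⊈1

      open Join J renaming (plane to π; dim₃ to dπ)

      abstract
        trans-⊆ : ∀ {R} → Meet (ℓ P₁) (ℓ R) → Meet (ℓ P₂) (ℓ R) → v ∉ ℓ R → ℓ R ⊆ π
        trans-⊆ {R} m₁ m₂ v∉ = transversal {ℓ P₁} {ℓ P₂} {v} {ℓ R} J (dim-ℓ P₁) (dim-ℓ P₂) v1 v2 2⊈1 (dim-ℓ R) (Meet-sym m₁) (Meet-sym m₂) v∉

        -- A line off `v` and not in `π` misses `ℓ P₁` or `ℓ P₂`. The missed line lies in `𝕊 R`; so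
        -- does the other one, or at least its common point with `ℓ R`, and this suffices to span
        -- `π`.
        off-point : ∀ {R} → C R → ¬ (ℓ R ⊆ π) → v ∉ ℓ R → π ⊆ 𝕊 R
        off-point {R} cR R⊈ v∉ with meet? (ℓ P₁) (ℓ R) | meet? (ℓ P₂) (ℓ R)
        ... | yes m₁ | yes m₂ = contradiction (λ {t} → trans-⊆ {R} m₁ m₂ v∉ {t}) R⊈
        ... | no d₁ | no d₂ = minimal (𝕊 R) (heavy⊆ {P₁} {R} h₁ cR d₁) (heavy⊆ {P₂} {R} h₂ cR d₂)
        ... | yes (u , u≢ , u1 , uR) | no d₂ =
          fill {ℓ P₂} {π} {𝕊 R} {u} (dim-ℓ P₂) dπ right (heavy⊆ {P₂} {R} h₂ cR d₂) (left u1) (ℓ⊆𝕊 R uR) λ u2 → d₂ (u , u≢ , u2 , uR)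
        ... | no d₁ | yes (u , u≢ , u2 , uR) =
          fill {ℓ P₁} {π} {𝕊 R} {u} (dim-ℓ P₁) dπ left (heavy⊆ {P₁} {R} h₁ cR d₁) (right u2) (ℓ⊆𝕊 R uR) λ u1 → d₁ (u , u≢ , u1 , uR)

        ∣π∣ : ∣ π ∣ ≤ q ^ 3
        ∣π∣ = ≤-reflexive (card dπ)

      -- The three heavy lines form a triangle in `π`. A class line not in `π` meets `π` in at most
      -- one point, hence misses a side, and its solid turns out to contain `π`. Such a line
      -- determines its solid and cannot be heavy; so all heavy lines lie in `π`, and the flags on
      -- the other lines form a `Bundle`.
      triangle : ∀ {P₃} → Heavy P₃ → v ∉ ℓ P₃ → Cover
      triangle {P₃} h₃ v∉3 = record
        { small = small₂ r ; Φ = planeFamily π ∣π∣ ; Λ = proj₁ Λ,cov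
        ; heavy = λ P hP → planeFamily-∋ {π} (ind₂ P) (heavy-in-π P hP)
        ; covers = λ P cP → covers P cP (ℓ P ⊆? π) }
        where
        3⊆π : ℓ P₃ ⊆ π
        3⊆π = trans-⊆ {P₃} (heavy-meet {P₁} {P₃} h₁ h₃) (heavy-meet {P₂} {P₃} h₂ h₃) v∉3
        π⊆ : ∀ {R} → C R → ¬ (ℓ R ⊆ π) → π ⊆ 𝕊 R
        π⊆ {R} cR R⊈ with v ∈? ℓ R
        ... | no v∉ = off-point {R} cR R⊈ v∉
        ... | yes vR with meet? (ℓ P₃) (ℓ R)
        ... | yes (u , u≢ , u3 , uR) = contradiction
          (same-point {ℓ R} {π} {u} {v} {ℓ P₃} (dim-ℓ R) R⊈ u≢ uR (3⊆π u3) vR (left v1) u3) v∉3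
        ... | no d = fill {ℓ P₃} {π} {𝕊 R} {v} (dim-ℓ P₃) dπ 3⊆π (heavy⊆ {P₃} {R} h₃ cR d) (left v1) (ℓ⊆𝕊 R vR) v∉3
        heavy-in-π : ∀ P → Heavy P → ℓ P ⊆ π
        heavy-in-π P (cP , R , cR , RP , R⊈P) with ℓ P ⊆? π
        ... | yes h = h
        ... | no P⊈ with u , uP , u∉ ← ⊈-witness {ℓ P} {π} P⊈ = contradiction
          (λ {t} → fill {π} {𝕊 R} {𝕊 P} {u} dπ (dim-𝕊 R) (π⊆ {R} cR λ h → P⊈ λ t → h (ℓ-⊇ {P} {R} RP t)) (π⊆ {P} cP P⊈)
            (ℓ⊆𝕊 R (ℓ-⊇ {P} {R} RP uP)) (ℓ⊆𝕊 P uP) u∉ {t}) R⊈P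
        module B = Bundle π dπ (λ P → C P × ¬ (ℓ P ⊆ π)) (λ P → C? P ×-dec ¬? (ℓ P ⊆? π)) proj₁ (λ {P} (c , o) → π⊆ {P} c o) proj₂
        Λ,cov = B.family v v≢
        covers : ∀ P → C P → Dec (ℓ P ⊆ π) → (planeFamily π ∣π∣ ∋ P) ⊎ (proj₁ Λ,cov ∋ P)
        covers P cP (yes h) = inj₁ (planeFamily-∋ {π} (ind₂ P) h)
        covers P cP (no h) = inj₂ (proj₂ Λ,cov P (cP , h))

      module Concurrent (conc : ∀ P → Heavy P → v ∈ ℓ P) where

        -- The heavy lines are among the q + 1 lines of `π` on `v`. By `off-point`, flags whose
        -- lines are neither on `v` nor in `π` form a `Bundle`.
        coplanar : (∀ P → Heavy P → ℓ P ⊆ π) → Cover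
        coplanar cop = record
          { small = small₃ r ; Φ = starInPlane π v v≢ (left v1) dπ
          ; Λ = (star v v≢ ∪ planeFamily π ∣π∣) ∪ proj₁ Λ,cov
          ; heavy = λ P hP → starInPlane-∋ {π} (ind₂ P) (cop P hP) (conc P hP)
          ; covers = λ P cP → inj₂ (covers P cP (v ∈? ℓ P) (ℓ P ⊆? π)) }
          where
          module B = Bundle π dπ (λ P → C P × ¬ (ℓ P ⊆ π) × v ∉ ℓ P) (λ P → C? P ×-dec ¬? (ℓ P ⊆? π) ×-dec ¬? (v ∈? ℓ P))
            proj₁ (λ {P} (c , o , n) → off-point {P} c o n) (λ (_ , o , _) → o)
          Λ,cov = B.family v v≢
          covers : ∀ P → C P → Dec (v ∈ ℓ P) → Dec (ℓ P ⊆ π) → ((star v v≢ ∪ planeFamily π ∣π∣) ∪ proj₁ Λ,cov) ∋ P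
          covers P cP (yes v∈) _ = inj₁ (inj₁ (star-∋ (ind₂ P) v∈))
          covers P cP (no _) (yes h) = inj₁ (inj₂ (planeFamily-∋ {π} (ind₂ P) h))
          covers P cP (no v∉) (no h) = inj₂ (proj₂ Λ,cov P (cP , h , v∉))

        -- Three non-coplanar heavy lines on `v` span a solid, and a class line off `v` can only
        -- have this solid, which is `𝕊 R₁`. So the heavy lines are among the θ₂ q lines of `𝕊 R₁`
        -- on `v`. If some class line `ℓ Q` on `v` leaves `𝕊 R₁`, the class lines off `v` lie in
        -- `𝕊 R₁ ∩ 𝕊 Q`, at most a plane.
        spatial : ∀ {P₃ R₁} → Heavy P₃ → ¬ (ℓ P₃ ⊆ π) → C R₁ → v ∉ ℓ R₁ → Cover
        spatial {P₃} {R₁} h₃ 3⊈π c₁ v∉₁ with ∃-flag? (λ P → C? P ×-dec (v ∈? ℓ P) ×-dec ¬? (ℓ P ⊆? 𝕊 R₁))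
                                            | ⊈-witness {ℓ P₃} {π} 3⊈π
        ... | found | (w , w3 , w∉) = result found
          where
          v∈𝕊 : ∀ {R} → C R → v ∉ ℓ R → v ∈ 𝕊 R
          v∈𝕊 {R} cR v∉ with meet? (ℓ P₁) (ℓ R) | meet? (ℓ P₂) (ℓ R) | meet? (ℓ P₃) (ℓ R)
          ... | no d | _ | _ = heavy⊆ {P₁} {R} h₁ cR d v1
          ... | yes _ | no d | _ = heavy⊆ {P₂} {R} h₂ cR d v2
          ... | yes _ | yes _ | no d = heavy⊆ {P₃} {R} h₃ cR d (conc P₃ h₃)
          -- Meeting the first two lines off `v` puts `ℓ R` into `π`, where `ℓ P₃` has only the
          -- point `v`.
          ... | yes m₁ | yes m₂ | yes (u , u≢ , u3 , uR) = contradiction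
            (same-point {ℓ P₃} {π} {u} {v} {ℓ R} (dim-ℓ P₃) 3⊈π u≢ u3 (trans-⊆ {R} m₁ m₂ v∉ uR) (conc P₃ h₃) (left v1) uR) v∉
          heavy⊆𝕊 : ∀ {R P} → C R → v ∉ ℓ R → Heavy P → ℓ P ⊆ 𝕊 R
          heavy⊆𝕊 {R} {P} cR v∉ hP with meet? (ℓ P) (ℓ R)
          ... | no d = heavy⊆ {P} {R} hP cR d
          ... | yes (u , u≢ , uP , uR) = fill {∅ ⊹ v} {ℓ P} {𝕊 R} {u} (dim-point v≢) (dim-ℓ P)
            (point-least {v} {ℓ P} (conc P hP)) (point-least {v} {𝕊 R} (v∈𝕊 {R} cR v∉)) uP (ℓ⊆𝕊 R uR)
            λ h → v∉ (point-least {u} {ℓ R} uR (point-sym u≢ h))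
          𝕊⊆ : ∀ {R} → C R → v ∉ ℓ R → 𝕊 R ⊆ 𝕊 R₁
          𝕊⊆ {R} cR v∉ = fill {π} {𝕊 R} {𝕊 R₁} {w} dπ (dim-𝕊 R) (π⊆ {R} cR v∉) (π⊆ {R₁} c₁ v∉₁)
            (heavy⊆𝕊 {R} {P₃} cR v∉ h₃ w3) (heavy⊆𝕊 {R₁} {P₃} c₁ v∉₁ h₃ w3) w∉
            where
            π⊆ : ∀ {R} → C R → v ∉ ℓ R → π ⊆ 𝕊 R
            π⊆ {R} cR v∉ = minimal (𝕊 R) (heavy⊆𝕊 {R} {P₁} cR v∉ h₁) (heavy⊆𝕊 {R} {P₂} cR v∉ h₂)
          Φ₀ : Family (θ₂ q)
          Φ₀ = starInSolid (𝕊 R₁) v v≢ (v∈𝕊 {R₁} c₁ v∉₁) (dim-𝕊 R₁)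
          heavy₀ : ∀ P → Heavy P → Φ₀ ∋ P
          heavy₀ P hP = starInSolid-∋ {𝕊 R₁} (ind₂ P) (heavy⊆𝕊 {R₁} {P} c₁ v∉₁ hP) (conc P hP)
          result : Dec (∃[ P ] (C P × v ∈ ℓ P × ¬ (ℓ P ⊆ 𝕊 R₁))) → Cover
          result (no none) = record
            { small = small₂ r ; Φ = Φ₀ ; Λ = solidFamily (𝕊 R₁) (∣𝕊∣ R₁) ; heavy = heavy₀
            ; covers = λ P cP → inj₂ (solidFamily-∋ {𝕊 R₁} (ind₂ P) (all P cP (v ∈? ℓ P))) }
            where
            all : ∀ P → C P → Dec (v ∈ ℓ P) → ℓ P ⊆ 𝕊 R₁
            all P cP (yes v∈) = decidable-stable (ℓ P ⊆? 𝕊 R₁) λ o → none (P , cP , v∈ , o)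
            all P cP (no v∉) = λ t → 𝕊⊆ {P} cP v∉ (ℓ⊆𝕊 P t)
          result (yes (Q , cQ , vQ , Q⊈)) = record
            { small = small₂ r ; Φ = Φ₀ ; Λ = weaken (star+plane≤solid r) (star v v≢ ∪ planeFamily (𝕊 R₁ ∩ 𝕊 Q) ∣∩∣) ; heavy = heavy₀
            ; covers = λ P cP → inj₂ (cov P cP (v ∈? ℓ P)) }
            where
            ∣∩∣ : ∣ 𝕊 R₁ ∩ 𝕊 Q ∣ ≤ q ^ 3
            ∣∩∣ = ∣∩∣-< {𝕊 R₁} {𝕊 Q} (dim-𝕊 Q) λ h → Q⊈ λ t → h (ℓ⊆𝕊 Q t)
            cov : ∀ P → C P → Dec (v ∈ ℓ P) → (star v v≢ ∪ planeFamily (𝕊 R₁ ∩ 𝕊 Q) ∣∩∣) ∋ P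
            cov P cP (yes v∈) = inj₁ (star-∋ (ind₂ P) v∈)
            cov P cP (no v∉) with nonadjacent cP cQ
            ... | inj₁ (u , u≢ , uP , uQ) = contradiction
              (same-point {ℓ Q} {𝕊 R₁} {u} {v} {ℓ P} (dim-ℓ Q) Q⊈ u≢ uQ (𝕊⊆ {P} cP v∉ (ℓ⊆𝕊 P uP)) vQ (v∈𝕊 {R₁} c₁ v∉₁) uP) v∉
            ... | inj₂ (inj₁ h) = inj₂ (planeFamily-∋ {𝕊 R₁ ∩ 𝕊 Q} (ind₂ P) λ t → mk∈ (𝕊⊆ {P} cP v∉ (ℓ⊆𝕊 P t) , h t))
            ... | inj₂ (inj₂ h) = contradiction (λ {t} z → 𝕊⊆ {P} cP v∉ (h {t} z)) Q⊈

    cover : (∀ v → v ∉ ∅ → ∃[ P ] (C P × v ∉ ℓ P)) → ∃[ v ] v ∉ ∅ → Cover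
    cover off (o , o≢) with ∃-flag? heavy?
    ... | no none with P₀ , c₀ , _ ← off o o≢ = OneHeavyLine.cover P₀ c₀ λ P hP → contradiction (P , hP) none
    ... | yes (P₁ , h₁) with ∃-flag? (λ P → heavy? P ×-dec ¬? (ℓ P ⊆? ℓ P₁))
    ... | no none = OneHeavyLine.cover P₁ (proj₁ h₁) λ P hP → decidable-stable (ℓ P ⊆? ℓ P₁) λ o → none (P , hP , o)
    ... | yes (P₂ , h₂ , 2⊈1) with heavy-meet {P₁} {P₂} h₁ h₂
    ... | v , v≢ , v1 , v2 = case
      where
      module T = TwoHeavyLines P₁ P₂ h₁ h₂ 2⊈1 v v≢ v1 v2
      case : Cover
      case with ∃-flag? (λ P → heavy? P ×-dec ¬? (v ∈? ℓ P))
      ... | yes (P₃ , h₃ , v∉) = T.triangle {P₃} h₃ v∉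
      ... | no none with ∃-flag? (λ P → heavy? P ×-dec ¬? (ℓ P ⊆? Join.plane T.J)) | off v v≢
      ... | no none′ | _ = T.Concurrent.coplanar (λ P hP → decidable-stable (v ∈? ℓ P) λ o → none (P , hP , o))
        λ P hP → decidable-stable (ℓ P ⊆? Join.plane T.J) λ o → none′ (P , hP , o)
      ... | yes (P₃ , h₃ , 3⊈) | (R₁ , c₁ , v∉₁) = T.Concurrent.spatial (λ P hP → decidable-stable (v ∈? ℓ P) λ o → none (P , hP , o))
        {P₃} {R₁} h₃ 3⊈ c₁ v∉₁

-- Double counting of flags on uncovered lines

module DoubleCounting (F : Field) (r : ℕ) (size : HasSize F (3 + r)) where

  open FiniteCounting
  open Arithmetic
  open VectorSpace F (2 + r) size 5
  open LinesAndFlags F (2 + r) size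
  open ColourClasses F r size

  p : ℕ
  p = 2 + r

  abstract
    outside-exists : ∀ {W U k m} → Dim W k → Dim U m → k < m → ∃[ x ] (x ∈ U × x ∉ W)
    outside-exists {W} {U} {k} {m} dW dU k<m = ⊈-witness {U} {W} λ h →
      <⇒≱ (^-monoʳ-< q (s≤s (s≤s z≤n)) k<m) (≤-trans (≤-reflexive (sym (card dU))) (≤-trans (∣∣-mono {U} {W} h) (≤-reflexive (card dW))))

    nonzero-exists : ∃[ v ] v ∉ ∅
    nonzero-exists with x , _ , n ← outside-exists {∅} {⊤} dim-∅ dim-⊤ (s≤s z≤n) = x , n

  -- `A` marks the points that count. It is taken to be the classes in point-pencils, all indices,
  -- or all indices but one.
  module Points {N : ℕ} (N≡ : N ≡ θ₃ q) (T : Fin N → V) (T≢ : ∀ i → T i ∉ ∅) (A : Fin N → Set) (A? : Decidable A) where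

    Good : V → Set
    Good x = x ∉ ∅ × ∀ i → A i → x ∉ ∅ ⊹ T i

    good? : Decidable Good
    good? x = ¬? (x ∈? ∅) ×-dec all? λ i → A? i →-dec ¬? (x ∈? (∅ ⊹ T i))

    Missing : V → V → Set
    Missing x y = Ind₂ x y × ∀ i → A i → T i ∉ line x y

    missing? : ∀ x y → Dec (Missing x y)
    missing? x y = ind₂? x y ×-dec all? λ i → A? i →-dec ¬? (T i ∈? line x y)

    missed : ℕ
    missed = cnt (¬? ∘ A?)

    abstract
      N≡′ : cnt A? + missed ≡ θ₃ q
      N≡′ = trans (cnt-¬ A? (¬? ∘ A?) (λ n → n) (λ n → n)) N≡

      -- There are q⁵ - 1 = p θ₃ q + p q⁴ nonzero vectors, and each of the θ₃ q - `missed` marked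
      -- points covers p of them.
      cnt-good : p * (q ^ 4 + missed) ≤ cnt good?
      cnt-good = +-cancelˡ-≤ (1 + cnt A? * p) _ _ (≤-trans (≤-reflexive (sym total)) (≤-trans (≤-reflexive (sym ∣⊤∣)) (≤-trans
        (cnt-⊎ (_∈? ⊤) (_∈? ∅) (λ x → cov? x ⊎-dec good? x) split)
        (≤-trans (+-monoʳ-≤ ∣ ∅ ∣ (cnt-⊎ (λ x → cov? x ⊎-dec good? x) cov? good? λ z → z))
        (≤-trans (+-mono-≤ (≤-reflexive ∣∅∣) (+-monoˡ-≤ (cnt good?) covered)) (≤-reflexive (sym (+-assoc 1 (cnt A? * p) (cnt good?)))))))))
        where
        total : q ^ 5 ≡ (1 + cnt A? * p) + p * (q ^ 4 + missed)
        total = trans (q⁵-1 p) (trans (cong (λ z → 1 + p * z + p * q ^ 4) (sym N≡′)) (rearr p (cnt A?) missed (q ^ 4)))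
          where
          rearr : ∀ p a m z → 1 + p * (a + m) + p * z ≡ 1 + a * p + p * (z + m)
          rearr = solve 4 (λ p a m z → con 1 :+ p :* (a :+ m) :+ p :* z := con 1 :+ a :* p :+ p :* (z :+ m)) refl
        On : Fin N → V → Set
        On i x = x ∈ ∅ ⊹ T i × x ∉ ∅
        on? : ∀ i x → Dec (On i x)
        on? i x = (x ∈? (∅ ⊹ T i)) ×-dec ¬? (x ∈? ∅)
        cov? : ∀ x → Dec (∃[ i ] (A i × On i x))
        cov? x = any? λ i → A? i ×-dec on? i x
        split : ∀ {x} → x ∈ ⊤ → x ∈ ∅ ⊎ ((∃[ i ] (A i × On i x)) ⊎ Good x)
        split {x} _ with x ∈? ∅ | cov? x
        ... | yes z | _ = inj₁ z
        ... | no z | yes c = inj₂ (inj₁ c)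
        ... | no z | no c = inj₂ (inj₂ (z , λ i a h → c (i , a , h , z)))
        covered : cnt cov? ≤ cnt A? * p
        covered = ≤-trans (cnt-∃ cov? (λ i x → A? i ×-dec on? i x) (λ z → z))
          (cnt₂-×-≤ (λ i x → A? i ×-dec on? i x) A? on? (λ z → z) ≤-refl
            λ {i} _ → cnt-∖∅ (∅ ⊹ T i) (≤-reflexive (∣point∣ (T≢ i))))

      -- There are θ₃ q lines on `x`, each with p q vectors off ⟨x⟩, and a marked point spoils only
      -- one of these lines.
      cnt-missing-through : ∀ {x} → Good x → missed * (p * q) ≤ cnt (missing? x)
      cnt-missing-through {x} (x≢ , off) = +-cancelˡ-≤ (cnt A? * (p * q)) _ _ (≤-trans
        (≤-reflexive (trans (sym (*-distribʳ-+ (p * q) (cnt A?) missed)) (cong (_* (p * q)) N≡′)))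
        (≤-trans total (≤-trans
          (cnt-⊎ (λ y → (y ∈? ⊤) ×-dec ¬? (y ∈? (∅ ⊹ x))) cov? (missing? x) split)
          (+-monoˡ-≤ _ covered))))
        where
        total : θ₃ q * (p * q) ≤ cnt (λ y → (y ∈? ⊤) ×-dec ¬? (y ∈? (∅ ⊹ x)))
        total = ≤-reflexive (+-cancelˡ-≡ q _ _ (trans (sym (q⁵-q p)) (trans (sym ∣⊤∣)
          (trans (sym (cnt-∖ {∅ ⊹ x} {⊤} λ _ → mk∈ refl)) (trans (+-comm _ ∣ ∅ ⊹ x ∣) (cong₂ _+_ (∣point∣ x≢) refl))))))
        Hit : Fin N → V → Set
        Hit i y = y ∈ ∅ ⊹ x ⊹ T i × y ∉ ∅ ⊹ x
        hit? : ∀ i y → Dec (Hit i y)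
        hit? i y = (y ∈? (∅ ⊹ x ⊹ T i)) ×-dec ¬? (y ∈? (∅ ⊹ x))
        cov? : ∀ y → Dec (∃[ i ] (A i × Hit i y))
        cov? y = any? λ i → A? i ×-dec hit? i y
        T∉ : ∀ {i} → A i → T i ∉ ∅ ⊹ x
        T∉ {i} a h = off i a (point-sym (T≢ i) h)
        split : ∀ {y} → y ∈ ⊤ × y ∉ ∅ ⊹ x → (∃[ i ] (A i × Hit i y)) ⊎ Missing x y
        split {y} (_ , y∉) with cov? y
        ... | yes c = inj₁ c
        ... | no c = inj₂ ((x≢ , y∉) , λ i a h → c (i , a , exchange h (T∉ a) , y∉))
        covered : cnt cov? ≤ cnt A? * (p * q)
        covered = ≤-trans (cnt-∃ cov? (λ i y → A? i ×-dec hit? i y) (λ z → z))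
          (cnt₂-×-≤ (λ i y → A? i ×-dec hit? i y) A? hit? (λ z → z) ≤-refl
            λ {i} a → cnt-∖point (∅ ⊹ x ⊹ T i) x≢ x∈line
              (≤-reflexive (trans (card (dim-line (x≢ , T∉ a))) (q²-q p))))

      -- Division by `bases p` gives the m (q⁴ + m) / (q + 1) of the overview. The lines are counted
      -- from their points, q + 1 on each, whence the denominator.
      cnt-missing : (p * (q ^ 4 + missed)) * (missed * (p * q)) ≤ cnt₂ missing?
      cnt-missing = cnt₂-×-≥ missing? good? cnt-good cnt-missing-through

  module Colours {N : ℕ} (N≡ : N ≡ θ₃ q) (col : Flag → Fin N)
    (nonadjacent : ∀ {P Q} → col P ≡ col Q → Meet (ℓ P) (ℓ Q) ⊎ (ℓ P ⊆ 𝕊 Q ⊎ ℓ Q ⊆ 𝕊 P)) where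

    Base : Fin N → V → Set
    Base i v = v ∉ ∅ × ∀ P → col P ≡ i → v ∈ ℓ P

    Pencil : Fin N → Set
    Pencil i = ∃ (Base i)

    abstract
      off? : ∀ i v → Dec (∃[ P ] (col P ≡ i × v ∉ ℓ P))
      off? i v = ∃-flag? λ P → (col P ≟ i) ×-dec ¬? (v ∈? ℓ P)

      base? : ∀ i v → Dec (Base i v)
      base? i v = ¬? (v ∈? ∅) ×-dec map′
        (λ n P e → decidable-stable (v ∈? ℓ P) λ o → n (P , e , o)) (λ h (P , e , o) → o (h P e)) (¬? (off? i v))

      pencil? : Decidable Pencil
      pencil? i = any? (base? i)

      off-pencil : ∀ {i} → ¬ Pencil i → ∀ v → v ∉ ∅ → ∃[ P ] (col P ≡ i × v ∉ ℓ P)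
      off-pencil {i} np v v≢ = decidable-stable (off? i v) λ n →
        np (v , v≢ , λ P e → decidable-stable (v ∈? ℓ P) λ o → n (P , e , o))

      -- A class in no point-pencil gets a dummy nonzero vector; `Points` is applied with
      -- `A = Pencil`, which leaves it unmarked.
      point : ∀ {i} → Dec (Pencil i) → V
      point (yes (v , _)) = v
      point (no _) = proj₁ nonzero-exists

      point≢ : ∀ {i} (d : Dec (Pencil i)) → point d ∉ ∅
      point≢ (yes (v , v≢ , _)) = v≢
      point≢ (no _) = proj₂ nonzero-exists

      point-base : ∀ {i} (d : Dec (Pencil i)) → Pencil i → ∀ P → col P ≡ i → point d ∈ ℓ P
      point-base (yes (v , _ , h)) _ = h
      point-base (no np) pn = contradiction pn np

    T : Fin N → V
    T i = point (pencil? i)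

    open Points N≡ T (λ i → point≢ (pencil? i)) Pencil pencil? public
      using (Missing; missing?; missed; cnt-missing)

    ΣΣ : (V → V → ℕ) → ℕ
    ΣΣ f = sum λ x → sum λ y → f x y

    -- heavy and light are 0/1-valued and together charge every line carrying a flag of colour i, heavy if there may be two solids.
    record Charge (i : Fin N) (np : ℕ) : Set where
      no-eta-equality
      field
        heavy light : V → V → ℕ
        heavy-total : ΣΣ heavy ≤ np * (θ₂ q * bases p)
        total : (q + 1) * ΣΣ (λ x y → θ₂ q * heavy x y + light x y) + np * bases p ≤ np * (((q ^ 4 + θ₂ q) * θ₂ q) * bases p)
        light≤ : ∀ x y → light x y ≤ np
        charged : ∀ P → (Pencil i → T i ∉ ℓ P) → col P ≡ i →
          1 ≤ heavy (x P) (y P) ⊎ (1 ≤ light (x P) (y P) × ∀ Q → col Q ≡ i → ℓ Q ⊆ ℓ P → 𝕊 Q ⊆ 𝕊 P)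

    -- A class in a point-pencil is charged nothing: the lines considered avoid its base point and
    -- carry none of its flags.
    charge : ∀ i (d : Dec (Pencil i)) → d ≡ pencil? i → Charge i ⟦ ¬? d ⟧
    charge i (yes pn) eq = record
      { heavy = λ _ _ → 0 ; light = λ _ _ → 0 ; heavy-total = ≤-reflexive ΣΣ-zero
      ; total = ≤-reflexive (trans (+-identityʳ _) (trans (cong ((q + 1) *_) ΣΣ-zero′) (*-zeroʳ (q + 1))))
      ; light≤ = λ _ _ → z≤n
      ; charged = λ P off e → contradiction (subst (λ d → point d ∈ ℓ P) eq (point-base (yes pn) pn P e)) (off pn) }
      where
      sum-zero : ∀ n → sum {n} (λ _ → 0) ≡ 0
      sum-zero n = trans (sum-const n 0) (*-zeroʳ n)
      ΣΣ-zero : ΣΣ (λ _ _ → 0) ≡ 0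
      ΣΣ-zero = trans (sum-cong-≗ {∣V∣} {λ _ → sum {∣V∣} λ _ → 0} {λ _ → 0} λ _ → sum-zero ∣V∣) (sum-zero ∣V∣)
      ΣΣ-zero′ : ΣΣ (λ _ _ → θ₂ q * 0 + 0) ≡ 0
      ΣΣ-zero′ = trans (sum-cong-≗ {∣V∣} λ _ → sum-cong-≗ {∣V∣} {λ _ → θ₂ q * 0 + 0} {λ _ → 0} λ _ → trans (+-identityʳ _) (*-zeroʳ (θ₂ q))) ΣΣ-zero
    charge i (no np) eq = record
      { heavy = λ x y → ⟦ has? Φ x y ⟧ ; light = λ x y → ⟦ has? Λ x y ⟧
      ; heavy-total = ≤-trans (bound Φ) (≤-trans (*-monoˡ-≤ (bases p) (Small.heavy≤ small)) (≤-reflexive (sym (+-identityʳ _))))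
      -- The strictness of `total<` supplies the extra `bases p`, which survives summation over the
      -- classes.
      ; total = ≤-trans (+-monoˡ-≤ (1 * bases p) (*-monoʳ-≤ (q + 1) sums)) (≤-trans (≤-reflexive (arrange (q + 1) (θ₂ q * φ + l) (bases p)))
          (≤-trans (*-monoˡ-≤ (bases p) (Small.total< small)) (≤-reflexive (sym (+-identityʳ _)))))
      ; light≤ = λ x y → ⟦⟧≤1 (has? Λ x y)
      ; charged = charged }
      where
      open Coclique (λ P → col P ≡ i) (λ P → col P ≟ i) (λ {P} {Q} a b → nonadjacent {P} {Q} (trans a (sym b)))
      open Cover (cover (off-pencil np) nonzero-exists)
      arrange : ∀ a b c → a * (b * c) + 1 * c ≡ suc (a * b) * c
      arrange a b c = trans (cong₂ _+_ (sym (*-assoc a b c)) (*-identityˡ c)) (+-comm (a * b * c) c)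
      sums : ΣΣ (λ x y → θ₂ q * ⟦ has? Φ x y ⟧ + ⟦ has? Λ x y ⟧) ≤ (θ₂ q * φ + l) * bases p
      sums = ≤-trans (≤-reflexive (ΣΣ-linear (θ₂ q) (λ x y → ⟦ has? Φ x y ⟧) (λ x y → ⟦ has? Λ x y ⟧)))
        (≤-trans (+-mono-≤ (*-monoʳ-≤ (θ₂ q) (bound Φ)) (bound Λ))
          (≤-reflexive (trans (cong (_+ l * bases p) (sym (*-assoc (θ₂ q) φ (bases p)))) (sym (*-distribʳ-+ (bases p) (θ₂ q * φ) l)))))
        where
        ΣΣ-linear : ∀ c (f g : V → V → ℕ) → ΣΣ (λ x y → c * f x y + g x y) ≡ c * ΣΣ f + ΣΣ g
        ΣΣ-linear c f g = trans (sum-cong-≗ λ x → trans (∑-distrib-+ (λ y → c * f x y) (g x))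
            (cong (_+ sum (g x)) (sym (*-distribˡ-sum c (f x)))))
          (trans (∑-distrib-+ (λ x → c * sum (f x)) (λ x → sum (g x))) (cong (_+ ΣΣ g) (sym (*-distribˡ-sum c (λ x → sum (f x))))))
      charged : ∀ P → (Pencil i → T i ∉ ℓ P) → col P ≡ i →
          1 ≤ ⟦ has? Φ (x P) (y P) ⟧ ⊎ (1 ≤ ⟦ has? Λ (x P) (y P) ⟧ × ∀ Q → col Q ≡ i → ℓ Q ⊆ ℓ P → 𝕊 Q ⊆ 𝕊 P)
      charged P _ e with heavy? P
      ... | yes h = inj₁ (≤-reflexive (sym (⟦⟧-true (has? Φ (x P) (y P)) (heavy P h))))
      ... | no ¬h with covers P e
      ... | inj₁ h = inj₁ (≤-reflexive (sym (⟦⟧-true (has? Φ (x P) (y P)) h)))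
      ... | inj₂ h = inj₂ (≤-reflexive (sym (⟦⟧-true (has? Λ (x P) (y P)) h)) ,
        λ Q e′ QP → decidable-stable (𝕊 Q ⊆? 𝕊 P) λ o → ¬h (e , Q , e′ , (λ {t} → QP {t}) , o))

    charges : ∀ i → Charge i ⟦ ¬? (pencil? i) ⟧
    charges i = charge i (pencil? i) refl

    heavy light : Fin N → V → V → ℕ
    heavy i = Charge.heavy (charges i)
    light i = Charge.light (charges i)

    Through : V → V → Fin N → V → V → Set
    Through x y i z w = Σ[ j ∈ Ind₄ x y z w ] col (flag x y z w j) ≡ i

    through? : ∀ x y i z w → Dec (Through x y i z w)
    through? x y i z w with ind₄? x y z w
    ... | no ¬j = no λ (j , _) → ¬j j
    ... | yes j = map′ (j ,_) proj₂ (col (flag x y z w j) ≟ i)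

    private
      -- The number of pairs z, w that extend a fixed line to a fixed solid containing it.
      perSolid : ℕ
      perSolid = (q ^ 2 * (p * (q + 1))) * (q ^ 3 * p)

    abstract
      cnt-extensions : ∀ {x y} → Ind₂ x y → θ₂ q * perSolid ≤ cnt₂ (λ z w → ¬? (z ∈? line x y) ×-dec ¬? (w ∈? (line x y ⊹ z)))
      cnt-extensions {x} {y} i = ≤-trans (≤-reflexive (sym (flags-on-line p)))
        (cnt₂-×-≥ (λ z w → ¬? (z ∈? line x y) ×-dec ¬? (w ∈? (line x y ⊹ z))) (λ z → ¬? (z ∈? line x y))
          (outside (dim-line i) (q⁵-q² p))
          λ {z} z∉ → ≤-trans (outside (dim-⊹ (dim-line i) z∉) (q⁵-q³ p))
            (cnt-mono (λ w → ¬? (w ∈? (line x y ⊹ z))) (λ w → ¬? (z ∈? line x y) ×-dec ¬? (w ∈? (line x y ⊹ z))) (z∉ ,_)))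
        where
        outside : ∀ {W k e} → Dim W k → q ^ 5 ≡ q ^ k + e → e ≤ cnt (λ z → ¬? (z ∈? W))
        outside {W} {k} {e} dW eq = ≤-reflexive (+-cancelˡ-≡ (q ^ k) _ _ (trans (sym eq) (trans (sym ∣V∣≡)
          (trans (sym (cnt-¬ (_∈? W) (λ z → ¬? (z ∈? W)) (λ n → n) (λ n → n))) (cong₂ _+_ (card dW) refl)))))

      cnt-in-solid : ∀ P → cnt₂ (λ z w → ((z ∈? 𝕊 P) ×-dec ¬? (z ∈? ℓ P)) ×-dec ((w ∈? 𝕊 P) ×-dec ¬? (w ∈? (ℓ P ⊹ z)))) ≤ perSolid
      cnt-in-solid P = cnt₂-×-≤ (λ z w → ((z ∈? 𝕊 P) ×-dec ¬? (z ∈? ℓ P)) ×-dec ((w ∈? 𝕊 P) ×-dec ¬? (w ∈? (ℓ P ⊹ z))))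
        (λ z → (z ∈? 𝕊 P) ×-dec ¬? (z ∈? ℓ P)) (λ z w → (w ∈? 𝕊 P) ×-dec ¬? (w ∈? (ℓ P ⊹ z)))
        (λ h → h) (inside {ℓ P} (ℓ⊆𝕊 P) (dim-ℓ P) (q⁴-q² p))
        λ {z} (zS , z∉) → inside {ℓ P ⊹ z} (⊹-least (ℓ⊆𝕊 P) zS) (dim-⊹ (dim-ℓ P) z∉) (q⁴-q³ p)
        where
        inside : ∀ {W k e} → W ⊆ 𝕊 P → Dim W k → q ^ 4 ≡ q ^ k + e → cnt (λ z → (z ∈? 𝕊 P) ×-dec ¬? (z ∈? W)) ≤ e
        inside {W} {k} {e} WS dW eq = ≤-reflexive (+-cancelʳ-≡ (q ^ k) _ _ (trans (cong (cnt (λ z → (z ∈? 𝕊 P) ×-dec ¬? (z ∈? W)) +_) (sym (card dW)))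
          (trans (cnt-∖ {W} {𝕊 P} WS) (trans (card (dim-𝕊 P)) (trans eq (+-comm (q ^ k) e))))))

      -- If class `i` has flags on the line and no heavy charge there, these flags share one solid,
      -- so they arise from at most `perSolid` pairs z, w.
      light-or-heavy : ∀ {x y} → Missing x y → ∀ i → 1 ≤ heavy i x y ⊎ cnt₂ (through? x y i) ≤ light i x y * perSolid
      light-or-heavy {x} {y} (_ , off) i with any? (λ z → any? λ w → through? x y i z w)
      ... | no none = inj₂ (≤-trans (cnt₂-×-≤ (through? x y i) (λ z → any? (through? x y i z)) (through? x y i)
              (λ {z} {w} t → (w , t) , t)
              (≤-reflexive (cnt-none (λ z → any? (through? x y i z)) λ z t → none (z , t))) (λ {z} _ → cnt≤n (through? x y i z)))
              z≤n)
      ... | yes (z , w , j , e) with Charge.charged (charges i) (flag x y z w j) (off i) e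
      ... | inj₁ h = inj₁ h
      ... | inj₂ (1≤ , solid) = inj₂ (≤-trans
          (≤-trans (cnt₂-mono (through? x y i) _ same) (cnt-in-solid P))
          (≤-trans (≤-reflexive (sym (*-identityˡ perSolid))) (*-monoˡ-≤ perSolid 1≤)))
        where
        P : Flag
        P = flag x y z w j
        same : ∀ {z w} → Through x y i z w → (z ∈ 𝕊 P × z ∉ ℓ P) × (w ∈ 𝕊 P × w ∉ ℓ P ⊹ z)
        same {z} {w} (j@(_ , z∉ , w∉) , e) = (S (⊹-old ⊹-new) , z∉) , (S ⊹-new , w∉)
          where
          S : 𝕊 (flag x y z w j) ⊆ 𝕊 P
          S = solid (flag x y z w j) e λ h → h

      -- Each of the at least `θ₂ q * perSolid` pairs extending the line gets some colour, and a
      -- colour takes at most `perSolid` of them for each unit of its light charge.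
      light-line : ∀ {x y} → Missing x y → (∀ i → ¬ (1 ≤ heavy i x y)) → θ₂ q ≤ sum λ i → light i x y
      light-line {x} {y} m@(ind , _) none = *-cancelʳ-≤ (θ₂ q) _ perSolid (≤-trans (cnt-extensions ind) (≤-trans
        (cnt₂-∃ (λ z w → ¬? (z ∈? line x y) ×-dec ¬? (w ∈? (line x y ⊹ z))) (through? x y)
          λ {z} {w} h → col (flag x y z w (ind , h)) , (ind , h) , refl)
        (≤-trans (sum-mono each) (≤-reflexive (sym (*-distribʳ-sum perSolid (λ i → light i x y)))))))
        where
        each : ∀ i → cnt₂ (through? x y i) ≤ light i x y * perSolid
        each i with light-or-heavy m i
        ... | inj₁ h = contradiction h (none i)
        ... | inj₂ h = h

      charge-missing : ∀ {x y} → Missing x y → θ₂ q ≤ sum λ i → θ₂ q * heavy i x y + light i x y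
      charge-missing {x} {y} m with any? (λ i → 1 ≤? heavy i x y)
      ... | yes (i , h) = ≤-trans (≤-trans (≤-reflexive (sym (*-identityʳ (θ₂ q)))) (*-monoʳ-≤ (θ₂ q) h))
              (≤-trans (m≤m+n _ (light i x y)) (term≤sum (λ i → θ₂ q * heavy i x y + light i x y) i))
      ... | no none = ≤-trans (light-line m λ i h → none (i , h)) (sum-mono λ i → m≤n+m _ (θ₂ q * heavy i x y))

      -- Otherwise every basis of an uncovered line has a heavy charge, but these charges total at
      -- most `missed * (θ₂ q * bases p)`, too little by `few-heavy-lines`.
      light-missing : 1 ≤ missed → ∃[ x ] ∃[ y ] (Missing x y × ∀ i → ¬ (1 ≤ heavy i x y))
      light-missing 1≤m with any? (λ x → any? λ y → missing? x y ×-dec all? λ i → ¬? (1 ≤? heavy i x y))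
      ... | yes (x , y , h) = x , y , h
      ... | no none = contradiction (≤-trans cnt-missing (≤-trans
          (sum-mono λ x → sum-mono λ y → each x y)
          (≤-trans (≤-reflexive (trans (sum-cong-≗ λ x → ∑-comm (λ y i → heavy i x y)) (∑-comm (λ x i → sum (heavy i x)))))
            (≤-trans (sum-mono λ i → Charge.heavy-total (charges i))
              (≤-reflexive (sym (*-distribʳ-sum (θ₂ q * bases p) (λ i → ⟦ ¬? (pencil? i) ⟧))))))))
          (<⇒≱ (few-heavy-lines r missed 1≤m))
        where
        each : ∀ x y → ⟦ missing? x y ⟧ ≤ sum λ i → heavy i x y
        each x y with missing? x y
        ... | no _ = z≤n
        ... | yes m with any? (λ i → 1 ≤? heavy i x y)
        ... | yes (i , h) = ≤-trans h (term≤sum (λ i → heavy i x y) i)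
        ... | no n = contradiction (x , y , m , λ i h → n (i , h)) none

      all-pencils : ∀ i → Pencil i
      all-pencils i with missed in eq
      ... | zero = decidable-stable (pencil? i) λ np → contradiction
        (≤-trans (≤-reflexive (sym (⟦⟧-true (¬? (pencil? i)) np))) (≤-trans (term≤sum (λ i → ⟦ ¬? (pencil? i) ⟧) i) (≤-reflexive eq))) λ ()
      ... | suc m with x , y , miss , none ← light-missing (≤-trans (s≤s z≤n) (≤-reflexive (sym eq))) =
        contradiction (≤-trans (*-mono-≤ 1≤m (bases-positive r)) (too-many-flags r missed (sum λ i → total i) 1≤m t≤m flags totals)) λ ()
        where
        1≤m : 1 ≤ missed
        1≤m = ≤-trans (s≤s z≤n) (≤-reflexive (sym eq))
        -- On the line found, the light charges sum to at least `θ₂ q`, and only the `missed`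
        -- classes contribute, at most 1 each.
        t≤m : θ₂ q ≤ missed
        t≤m = ≤-trans (light-line miss none) (sum-mono λ i → Charge.light≤ (charges i) x y)
        total : Fin N → ℕ
        total i = ΣΣ λ x y → θ₂ q * heavy i x y + light i x y
        flags : θ₂ q * ((p * (q ^ 4 + missed)) * (missed * (p * q))) ≤ sum λ i → total i
        flags = ≤-trans (*-monoʳ-≤ (θ₂ q) cnt-missing) (≤-trans
          (≤-reflexive (trans (*-distribˡ-sum (θ₂ q) (λ x → cnt (missing? x))) (sum-cong-≗ λ x → *-distribˡ-sum (θ₂ q) (λ y → ⟦ missing? x y ⟧))))
          (≤-trans (sum-mono λ x → sum-mono λ y → each x y (missing? x y))
            (≤-reflexive (trans (sum-cong-≗ λ x → ∑-comm (λ y i → θ₂ q * heavy i x y + light i x y))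
              (∑-comm (λ x i → sum λ y → θ₂ q * heavy i x y + light i x y))))))
          where
          each : ∀ x y (d : Dec (Missing x y)) → θ₂ q * ⟦ d ⟧ ≤ sum λ i → θ₂ q * heavy i x y + light i x y
          each x y (no _) = ≤-trans (≤-reflexive (*-zeroʳ (θ₂ q))) z≤n
          each x y (yes m) = ≤-trans (≤-reflexive (*-identityʳ (θ₂ q))) (charge-missing m)
        totals : (q + 1) * (sum λ i → total i) + missed * bases p ≤ missed * (((q ^ 4 + θ₂ q) * θ₂ q) * bases p)
        totals = ≤-trans (≤-reflexive (trans
            (cong₂ _+_ (*-distribˡ-sum (q + 1) total) (*-distribʳ-sum (bases p) (λ i → ⟦ ¬? (pencil? i) ⟧)))
            (sym (∑-distrib-+ (λ i → (q + 1) * total i) (λ i → ⟦ ¬? (pencil? i) ⟧ * bases p)))))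
          (≤-trans (sum-mono λ i → Charge.total (charges i))
            (≤-reflexive (sym (*-distribʳ-sum (((q ^ 4 + θ₂ q) * θ₂ q) * bases p) (λ i → ⟦ ¬? (pencil? i) ⟧)))))

-- Sets of θ₃ q points that block all lines

module BlockingSets (F : Field) (r : ℕ) (size : HasSize F (3 + r)) where

  open FiniteCounting
  open Arithmetic
  open VectorSpace F (2 + r) size 5
  open LinesAndFlags F (2 + r) size
  open ColourClasses F r size
  open DoubleCounting F r size

  Blocks : ∀ {N} → (Fin N → V) → Set
  Blocks T = ∀ {x y} → Ind₂ x y → ∃[ i ] T i ∈ line x y

  module BlockingSet {N : ℕ} (N≡ : N ≡ θ₃ q) (T : Fin N → V) (T≢ : ∀ i → T i ∉ ∅) (blocks : Blocks T) where

    abstract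
      off-exists : ∃[ x ] (x ∉ ∅ × ∀ i → x ∉ ∅ ⊹ T i)
      off-exists = go (cnt-pos P.good? (≤-trans (s≤s z≤n) P.cnt-good))
        where
        module P = Points N≡ T T≢ (λ i → i ≡ i) (λ i → yes refl)
        go : ∃ P.Good → ∃[ x ] (x ∉ ∅ × ∀ i → x ∉ ∅ ⊹ T i)
        go (x , x≢ , off) = x , x≢ , λ i → off i refl

      -- Without T j the other points cannot block all lines on x.
      separated : ∀ {x i j} → x ∉ ∅ → (∀ k → x ∉ ∅ ⊹ T k) → i ≢ j → T j ∉ ∅ ⊹ x ⊹ T i
      separated {x} {i} {j} x≢ off i≢j j∈ = go (cnt-pos (P.missing? x)
          (≤-trans (*-mono-≤ 1≤missed (s≤s z≤n)) (P.cnt-missing-through (x≢ , λ k _ → off k))))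
        where
        module P = Points N≡ T T≢ (λ k → k ≢ j) (λ k → ¬? (k ≟ j))
        1≤missed : 1 ≤ P.missed
        1≤missed = ≤-trans (≤-reflexive (sym (⟦⟧-true (¬? (¬? (j ≟ j))) λ n → n refl)))
          (term≤sum (λ k → ⟦ ¬? (¬? (k ≟ j)) ⟧) j)
        go : ¬ (∃[ y ] P.Missing x y)
        go (y , ind , miss) with blocks ind
        ... | k , k∈ with k ≟ j
        ... | no k≢j = miss k k≢j k∈
        ... | yes refl = miss i i≢j (line-least {x} {T j} {line x y} x∈line k∈
                (exchange j∈ λ h → off j (point-sym (T≢ j) h)))

      distinct : ∀ {i j} → T j ∈ ∅ ⊹ T i → i ≡ j
      distinct {i} {j} h with i ≟ j | off-exists
      ... | yes e | _ = e
      ... | no n | x , x≢ , off = contradiction (⊹-least {∅} {∅ ⊹ x ⊹ T i} (∅-least {∅ ⊹ x ⊹ T i}) ⊹-new h) (separated x≢ off n)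

    Covered : V → Set
    Covered v = v ∈ ∅ ⊎ ∃[ i ] v ∈ ∅ ⊹ T i

    covered? : Decidable Covered
    covered? v = (v ∈? ∅) ⊎-dec any? λ i → v ∈? (∅ ⊹ T i)

    abstract
      -- For different points i and j, the line joining them contains `u ⊕ v`. Were this vector
      -- uncovered, it would see both points on one line, against `separated`.
      covered-⊕ : ∀ {u v} → Covered u → Covered v → Covered (u ⊕ v)
      covered-⊕ {u} {v} (inj₁ (mk∈ refl)) b = subst Covered (trans (sym (⊕-identityʳ v)) (⊕-comm v 𝟘)) b
      covered-⊕ {u} {v} a (inj₁ (mk∈ refl)) = subst Covered (sym (⊕-identityʳ u)) a
      covered-⊕ {u} {v} (inj₂ (i , a)) (inj₂ (j , b)) with covered? (u ⊕ v)
      ... | yes c = c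
      ... | no n with i ≟ j | v ∈? ∅
      ... | yes refl | _ = inj₂ (i , ∈-⊕ (∅ ⊹ T i) a b)
      ... | no _ | yes (mk∈ refl) = subst Covered (sym (⊕-identityʳ u)) (inj₂ (i , a))
      ... | no i≢j | no v≢ = contradiction
          (point-least {v} {W} (∈-⊕⁻ W F.1# u∈ (subst (_∈ W) (trans (⊕-comm u v) (cong (v ⊕_) (sym (·-identity u)))) s∈)) (point-sym v≢ b))
          (separated {u ⊕ v} {i} {j} (λ z → n (inj₁ z)) (λ k h → n (inj₂ (k , h))) i≢j)
        where
        module F = Field F
        W : Sub
        W = ∅ ⊹ (u ⊕ v) ⊹ T i
        u∈ : u ∈ W
        u∈ = point-least {T i} {W} ⊹-new a
        s∈ : u ⊕ v ∈ W
        s∈ = x∈line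

      covered-· : ∀ a {v} → Covered v → Covered (a · v)
      covered-· a (inj₁ h) = inj₁ (∈-· ∅ a h)
      covered-· a (inj₂ (i , h)) = inj₂ (i , ∈-· (∅ ⊹ T i) a h)

    H : Sub
    H = record { Mem = Covered ; mem? = covered? ; mem𝟘 = inj₁ (∈-𝟘 ∅) ; mem⊕ = covered-⊕ ; mem· = covered-· }

    abstract
      T∈H : ∀ i → T i ∈ H
      T∈H i = mk∈ (inj₂ (i , ⊹-new))

      ∈H : ∀ {v} → v ∉ ∅ → v ∈ H → ∃[ i ] v ∈ ∅ ⊹ T i
      ∈H v≢ (mk∈ (inj₁ z)) = contradiction z v≢
      ∈H v≢ (mk∈ (inj₂ h)) = h

      -- Every line on an uncovered `x` contains one of the points, so `H` and `x` span V, and the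
      -- size of `H` follows by division.
      dim-H : Dim H 4
      dim-H with x , x≢ , off ← off-exists = mkDim (*-cancelˡ-≡ _ _ q (trans (sym (∣⊹∣ {H} x∉H))
          (trans (≤-antisym (∣∣-mono {H ⊹ x} {⊤} λ _ → mk∈ refl) (∣∣-mono {⊤} {H ⊹ x} λ {y} _ → all y)) ∣⊤∣)))
        where
        x∉H : x ∉ H
        x∉H h with i , k ← ∈H x≢ h = off i k
        all : ∀ y → y ∈ H ⊹ x
        all y with y ∈? (∅ ⊹ x)
        ... | yes h = point-least {x} {H ⊹ x} ⊹-new h
        ... | no y∉ with i , h ← blocks (x≢ , y∉) =
          line-least {x} {T i} {H ⊹ x} ⊹-new (⊹-old (T∈H i)) (exchange h λ k → off i (point-sym (T≢ i) k))

  -- Two point-pencils containing the same class give two blocking sets that differ in one point;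
  -- comparing these shows that the pencils coincide.
  module Exchange {N : ℕ} (N≡ : N ≡ θ₃ q) (T : Fin N → V) (T≢ : ∀ i → T i ∉ ∅) (blocks : Blocks T) (i : Fin N) (v : V) (v≢ : v ∉ ∅) where

    pick : ∀ {j} → Dec (j ≡ i) → V
    pick (yes _) = v
    pick {j} (no _) = T j

    T′ : Fin N → V
    T′ j = pick (j ≟ i)

    T′≢ : ∀ j → T′ j ∉ ∅
    T′≢ j with j ≟ i
    ... | yes _ = v≢
    ... | no _ = T≢ j

    T′-other : ∀ {j} → j ≢ i → T′ j ≡ T j
    T′-other {j} n with j ≟ i
    ... | yes e = contradiction e n
    ... | no _ = refl

    -- Both families cover a hyperplane; the part missing from the first point spans it already.
    exchanged : Blocks T′ → v ∈ ∅ ⊹ T i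
    exchanged blocks′ = decidable-stable (v ∈? (∅ ⊹ T i)) λ v∉ → impossible v∉ (outside-exists {∅ ⊹ T i} {B.H} (dim-point (T≢ i)) B.dim-H (s≤s (s≤s z≤n)))
      where
      module F = Field F
      module B = BlockingSet N≡ T T≢ blocks
      module B′ = BlockingSet N≡ T′ T′≢ blocks′
      old : ∀ {y} → y ∉ ∅ → y ∈ B.H → y ∉ ∅ ⊹ T i → y ∈ B′.H
      old {y} y≢ yH y∉ with B.∈H y≢ yH
      ... | j , h = point-least {T j} {B′.H} (subst (_∈ B′.H) (T′-other (λ { refl → y∉ h })) (B′.T∈H j)) h
      sum∈ : ∀ {y} → T i ⊕ y ∈ ∅ ⊹ T i → y ∈ ∅ ⊹ T i
      sum∈ {y} h = ∈-⊕⁻ (∅ ⊹ T i) F.1# ⊹-new (subst (_∈ ∅ ⊹ T i) (trans (⊕-comm (T i) y) (cong (y ⊕_) (sym (·-identity (T i))))) h)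
      -- `T i` is the difference of `T i ⊕ y` and `y`. Both lie in the first hyperplane and off ⟨T
      -- i⟩, so both lie in the second.
      Ti∈H′ : ∀ {y} → y ∈ B.H → y ∉ ∅ ⊹ T i → T i ∈ B′.H
      Ti∈H′ {y} yH y∉ = ∈-⊕⁻ B′.H F.1# (old (λ z → y∉ (∅-least {∅ ⊹ T i} z)) yH y∉)
          (subst (_∈ B′.H) (cong (T i ⊕_) (sym (·-identity y)))
            (old (λ z → y∉ (sum∈ (∅-least {∅ ⊹ T i} z))) (∈-⊕ B.H (B.T∈H i) yH) (λ h → y∉ (sum∈ h))))
      impossible : v ∉ ∅ ⊹ T i → ¬ (∃[ y ] (y ∈ B.H × y ∉ ∅ ⊹ T i))
      impossible v∉ (y , yH , y∉) with B′.∈H (T≢ i) (Ti∈H′ yH y∉)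
      ... | l , h with l ≟ i
      ... | yes refl = v∉ (point-sym (T≢ i) h)
      ... | no n = contradiction (B.distinct h) n

-- Translation between the subspaces of the statement and the numbered ones

module Translation (F : Field) (r : ℕ) (size : HasSize F (3 + r)) where

  open FiniteCounting
  open Arithmetic
  open VectorSpace F (2 + r) size 5
  open LinesAndFlags F (2 + r) size
  open ColourClasses F r size
  open DoubleCounting F r size

  private
    module F = Field F
    module S = Flags F

  abstract
    code-≈ : ∀ {u v} → code u ≡ code v → u S.≈v v
    code-≈ {u} {v} e i = F.trans (F.sym (vec-code u i)) (F.trans (F.reflexive (cong (λ x → vec x i) e)) (vec-code v i))

    code-0 : code S.0v ≡ 𝟘
    code-0 = vec-injective λ i → F.trans (vec-code _ i) (F.sym (vec-𝟘 i))

    code-+ : ∀ u v → code (u S.+v v) ≡ code u ⊕ code v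
    code-+ u v = vec-injective λ i → F.trans (vec-code _ i)
      (F.sym (F.trans (vec-⊕ _ _ i) (F.+-cong (vec-code u i) (vec-code v i))))

    code-· : ∀ a u → code (a S.·v u) ≡ a · code u
    code-· a u = vec-injective λ i → F.trans (vec-code _ i) (F.sym (F.trans (vec-· _ _ i) (F.*-congˡ (vec-code u i))))

  combination : ∀ {k} → (Fin k → K) → (Fin k → V) → V
  combination {zero}  c b = 𝟘
  combination {suc k} c b = c zero · b zero ⊕ combination (c ∘ suc) (b ∘ suc)

  span : ∀ {k} → (Fin k → V) → Sub
  span {zero}  b = ∅
  span {suc k} b = span (b ∘ suc) ⊹ b zero

  data Independent : ∀ {k} → (Fin k → V) → Set where
    []  : ∀ {b : Fin 0 → V} → Independent b
    _∷_ : ∀ {k} {b : Fin (suc k) → V} → b zero ∉ span (b ∘ suc) → Independent (b ∘ suc) → Independent b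

  abstract
    code-lincomb : ∀ {k} (c : Fin k → K) (b : Fin k → S.V) → code (S.lincomb c b) ≡ combination c (code ∘ b)
    code-lincomb {zero}  c b = code-0
    code-lincomb {suc k} c b = trans (code-+ _ _) (cong₂ _⊕_ (code-· _ _) (code-lincomb (c ∘ suc) (b ∘ suc)))

    code-lincomb-vec : ∀ {k} (c : Fin k → K) (b : Fin k → V) → code (S.lincomb c (vec ∘ b)) ≡ combination c b
    code-lincomb-vec {zero}  c b = code-0
    code-lincomb-vec {suc k} c b = trans (code-+ _ _)
      (cong₂ _⊕_ (trans (code-· _ _) (cong (c zero ·_) (code-vec (b zero)))) (code-lincomb-vec (c ∘ suc) (b ∘ suc)))

    combination∈ : ∀ {k} {W} (c : Fin k → K) (b : Fin k → V) → (∀ i → b i ∈ W) → combination c b ∈ W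
    combination∈ {zero}  {W} c b h = ∈-𝟘 W
    combination∈ {suc k} {W} c b h = ∈-⊕ W (∈-· W (c zero) (h zero)) (combination∈ {W = W} (c ∘ suc) (b ∘ suc) (h ∘ suc))

    basis∈span : ∀ {k} (b : Fin k → V) i → b i ∈ span b
    basis∈span b zero    = ⊹-new
    basis∈span b (suc i) = ⊹-old (basis∈span (b ∘ suc) i)

    span-combination : ∀ {k} (b : Fin k → V) {v} → v ∈ span b → ∃[ c ] v ≡ combination c b
    span-combination {zero}  b (mk∈ e) = (λ ()) , e
    span-combination {suc k} b {v} h with a , h′ ← ⊹-elim (span (b ∘ suc)) h with c , e ← span-combination (b ∘ suc) h′ =
      (λ { zero → F.- a ; (suc i) → c i })
      , trans (sym (⊕-cancel a (b zero) v)) (trans (cong (_⊕ (F.- a) · b zero) e) (⊕-comm _ _))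

    span-least : ∀ {k} {W} (b : Fin k → V) → (∀ i → b i ∈ W) → span b ⊆ W
    span-least {W = W} b h v∈ with c , refl ← span-combination b v∈ = combination∈ {W = W} c b h

    dim-span : ∀ {k} {b : Fin k → V} → Independent b → Dim (span b) k
    dim-span []       = dim-∅
    dim-span (n ∷ is) = dim-⊹ (dim-span is) n

    independent⇒ : ∀ {k} {b : Fin k → V} → Independent b → ∀ c → combination c b ≡ 𝟘 → ∀ i → c i F.≈ F.0#
    independent⇒ {suc k} {b} (n ∷ is) c e = λ { zero → c₀≈0 ; (suc i) → independent⇒ is (c ∘ suc) rest i }
      where
      W : Sub
      W = span (b ∘ suc)
      tail∈ : combination (c ∘ suc) (b ∘ suc) ∈ W
      tail∈ = combination∈ {W = W} (c ∘ suc) (b ∘ suc) (basis∈span (b ∘ suc))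
      c₀≈0 : c zero F.≈ F.0#
      c₀≈0 = decidable-stable (c zero ≈? F.0#) λ c≉ → n (∈-·⁻ W c≉ (∈-⊕⁻ W F.1# tail∈
        (subst (_∈ W) (trans (sym e) (cong (c zero · b zero ⊕_) (sym (·-identity _)))) (∈-𝟘 W))))
      rest : combination (c ∘ suc) (b ∘ suc) ≡ 𝟘
      rest = trans (sym (⊕-identityʳ _)) (trans (⊕-comm _ 𝟘)
        (trans (cong (_⊕ combination (c ∘ suc) (b ∘ suc)) (sym (trans (·-cong (b zero) c₀≈0) (·-zeroˡ (b zero))))) e))

    ⇒independent : ∀ {k} (b : Fin k → V) → (∀ c → combination c b ≡ 𝟘 → ∀ i → c i F.≈ F.0#) → Independent b
    ⇒independent {zero}  b h = []
    ⇒independent {suc k} b h = b₀∉ ∷ ⇒independent (b ∘ suc) λ c e i →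
        h (λ { zero → F.0# ; (suc i) → c i })
          (trans (cong₂ _⊕_ (·-zeroˡ (b zero)) e) (⊕-identityʳ 𝟘)) (suc i)
      where
      b₀∉ : b zero ∉ span (b ∘ suc)
      b₀∉ b∈ with c , e ← span-combination (b ∘ suc) b∈ = minus-one (h (λ { zero → F.- F.1# ; (suc i) → c i }) (vanish c e) zero)
        where
        minus-one : ¬ (F.- F.1# F.≈ F.0#)
        minus-one z = F.1≉0 (F.trans (F.sym (F.+-identityˡ F.1#)) (F.trans (F.+-congʳ (F.sym z)) (F.-‿inverseˡ F.1#)))
        vanish : ∀ c → b zero ≡ combination c (b ∘ suc) → (F.- F.1#) · b zero ⊕ combination c (b ∘ suc) ≡ 𝟘
        vanish c e = trans (cong ((F.- F.1#) · b zero ⊕_) (trans (sym e) (sym (·-identity (b zero)))))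
          (trans (sym (·-distribʳ (F.- F.1#) F.1# (b zero))) (trans (·-cong (b zero) (F.-‿inverseˡ F.1#)) (·-zeroˡ (b zero))))

  subspace : Sub → S.Subspace
  subspace W = record
    { _∈_ = λ v → code v ∈ W
    ; ∈-resp = λ h → subst (_∈ W) (code-cong h)
    ; 0∈ = subst (_∈ W) (sym code-0) (∈-𝟘 W)
    ; +∈ = λ a b → subst (_∈ W) (sym (code-+ _ _)) (∈-⊕ W a b)
    ; ·∈ = λ a h → subst (_∈ W) (sym (code-· a _)) (∈-· W a h) }

  abstract
    basis : ∀ {W k} → Dim W k → ∀ j → j ≤ k → Σ[ b ∈ (Fin j → V) ] (Independent b × ∀ i → b i ∈ W)
    basis dW zero    _   = (λ ()) , [] , λ ()
    basis {W} dW (suc j) j<k with b , ind , b∈ ← basis {W} dW j (<⇒≤ j<k)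
      with x , xW , x∉ ← outside-exists {span b} {W} (dim-span ind) dW j<k =
      (λ { zero → x ; (suc i) → b i }) , x∉ ∷ ind , λ { zero → xW ; (suc i) → b∈ i }

    hasDim : ∀ {W k} → Dim W k → S.HasDim (subspace W) k
    hasDim {W} {k} dW with b , ind , b∈ ← basis {W} dW k ≤-refl =
      vec ∘ b
      , (λ i → subst (_∈ W) (sym (code-vec (b i))) (b∈ i))
      , (λ c h → independent⇒ ind c (trans (sym (code-lincomb-vec c b)) (trans (code-cong h) code-0)))
      , λ v v∈ → let c , e = span-combination b (dim-unique-⊆ (span-least b b∈) (dim-span ind) dW v∈)
                 in c , code-≈ (trans e (sym (code-lincomb-vec c b)))

  -- Membership in a subspace of the statement is an arbitrary predicate; the basis in `HasDim`
  -- yields a decidable subspace with the same elements.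
  module Decided (W : S.Subspace) {k : ℕ} (dW : S.HasDim W k) where
    private
      b : Fin k → S.V
      b = proj₁ dW

    sub : Sub
    sub = span (code ∘ b)

    abstract
      dim-sub : Dim sub k
      dim-sub = dim-span (⇒independent (code ∘ b) λ c e →
        proj₁ (proj₂ (proj₂ dW)) c (code-≈ (trans (code-lincomb c b) (trans e (sym code-0)))))

      ∈⇒ : ∀ {v} → S._∈_ W v → code v ∈ sub
      ∈⇒ {v} h with c , e ← proj₂ (proj₂ (proj₂ dW)) v h =
        subst (_∈ sub) (sym (trans (code-cong e) (code-lincomb c b))) (combination∈ {W = sub} c (code ∘ b) (basis∈span (code ∘ b)))

      ⇐∈ : ∀ {v} → code v ∈ sub → S._∈_ W v
      ⇐∈ h with c , e ← span-combination (code ∘ b) h =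
        S.∈-resp W (λ i → F.sym (code-≈ (trans e (sym (code-lincomb c b))) i)) (lincomb∈ c b (proj₁ (proj₂ dW)))
        where
        lincomb∈ : ∀ {k} (c : Fin k → K) (b : Fin k → S.V) → (∀ i → S._∈_ W (b i)) → S._∈_ W (S.lincomb c b)
        lincomb∈ {zero}  c b h = S.0∈ W
        lincomb∈ {suc k} c b h = S.+∈ W (S.·∈ W (c zero) (h zero)) (lincomb∈ (c ∘ suc) (b ∘ suc) (h ∘ suc))

      vec∈ : ∀ {x} → x ∈ sub → S._∈_ W (vec x)
      vec∈ {x} h = ⇐∈ (subst (_∈ sub) (sym (code-vec x)) h)

      ∈vec : ∀ {x} → S._∈_ W (vec x) → x ∈ sub
      ∈vec {x} h = subst (_∈ sub) (code-vec x) (∈⇒ h)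

  toFlag24 : Flag → S.Flag24
  toFlag24 P = record { α = subspace (ℓ P) ; β = subspace (𝕊 P) ; α⊆β = λ v → ℓ⊆𝕊 P ; dimα = hasDim (dim-ℓ P) ; dimβ = hasDim (dim-𝕊 P) }

  abstract
    extend : ∀ {B x y} → Ind₂ x y → Dim B 4 → line x y ⊆ B → Σ[ z ∈ V ] Σ[ w ∈ V ] (Ind₄ x y z w × line x y ⊹ z ⊹ w ⊆ B)
    extend {B} {x} {y} i dB LB with z , zB , z∉ ← outside-exists {line x y} {B} (dim-line i) dB (s≤s (s≤s (s≤s z≤n)))
      with w , wB , w∉ ← outside-exists {line x y ⊹ z} {B} (dim-⊹ (dim-line i) z∉) dB (s≤s (s≤s (s≤s (s≤s z≤n)))) =
      z , w , (i , z∉ , w∉) , ⊹-least (⊹-least LB zB) wB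

  module _ (P : S.Flag24) where
    private
      module A = Decided (S.α P) (S.dimα P)
      module B = Decided (S.β P) (S.dimβ P)

    abstract
      A⊆B : A.sub ⊆ B.sub
      A⊆B h = B.∈vec (S.α⊆β P _ (A.vec∈ h))

      fromFlag24 : Σ[ G ∈ Flag ] P S.≐F toFlag24 G
      fromFlag24 with x , xA , x∉ ← outside-exists {∅} dim-∅ A.dim-sub (s≤s z≤n)
        with y , yA , y∉ ← outside-exists {∅ ⊹ x} (dim-point x∉) A.dim-sub (s≤s (s≤s z≤n))
        with z , w , i , SB ← extend {B.sub} (x∉ , y∉) B.dim-sub (line-least {x} {y} {B.sub} (A⊆B xA) (A⊆B yA)) =
        flag x y z w i
        , ((λ v h → dim-unique-⊆ {line x y} {A.sub} (line-least {x} {y} {A.sub} xA yA) (dim-line (x∉ , y∉)) A.dim-sub (A.∈⇒ h))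
          , λ v h → A.⇐∈ (line-least {x} {y} {A.sub} xA yA h))
        , ((λ v h → dim-unique-⊆ {𝕊 (flag x y z w i)} {B.sub} SB (dim-𝕊 (flag x y z w i)) B.dim-sub (B.∈⇒ h))
          , λ v h → B.⇐∈ (SB h))

  abstract
    spanAll : ∀ {U W} → Dim W 4 → ¬ (U ⊆ W) → S.SpanAll (subspace U) (subspace W)
    spanAll {U} {W} dW U⊈W v with x , xU , x∉ ← ⊈-witness {U} {W} U⊈W
      with a , h ← ⊹-elim W (dim-unique-⊆ {W ⊹ x} {⊤} (λ _ → mk∈ refl) (dim-⊹ dW x∉) dim-⊤ {code v} (mk∈ refl)) =
      vec ((F.- a) · x) , vec (code v ⊕ a · x)
      , subst (_∈ U) (sym (code-vec _)) (∈-· U _ xU) , subst (_∈ W) (sym (code-vec _)) h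
      , code-≈ (sym (trans (code-+ _ _) (trans (cong₂ _⊕_ (code-vec _) (code-vec _)) (trans (⊕-comm _ _) (⊕-cancel a x (code v))))))

    spanAll-sym : ∀ {U W} → Dim U 4 → ¬ (W ⊆ U) → S.SpanAll (subspace U) (subspace W)
    spanAll-sym {U} {W} dU W⊈U v with w , u , w∈ , u∈ , e ← spanAll {W} {U} dU W⊈U v =
      u , w , u∈ , w∈ , λ i → F.trans (e i) (F.+-comm _ _)

    -- A solid is a hyperplane, so any vector outside it completes it to V. This settles the two
    -- mixed conditions, and the one on the two solids because `ℓ P` already leaves `𝕊 Q`.
    adjacent : ∀ {P Q} → ¬ Meet (ℓ P) (ℓ Q) → ¬ (ℓ P ⊆ 𝕊 Q) → ¬ (ℓ Q ⊆ 𝕊 P) → S.Adjacent (toFlag24 P) (toFlag24 Q)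
    adjacent {P} {Q} d PQ QP =
      inj₁ (λ v vP vQ → trivial v vP vQ (code v ∈? ∅))
      , inj₂ (spanAll {ℓ P} {𝕊 Q} (dim-𝕊 Q) PQ)
      , inj₂ (spanAll-sym {𝕊 P} {ℓ Q} (dim-𝕊 P) QP)
      , inj₂ (spanAll {𝕊 P} {𝕊 Q} (dim-𝕊 Q) λ h → PQ λ t → h (ℓ⊆𝕊 P t))
      where
      trivial : ∀ v → code v ∈ ℓ P → code v ∈ ℓ Q → Dec (code v ∈ ∅) → v S.≈v S.0v
      trivial v vP vQ (yes (mk∈ e)) = code-≈ (trans e (sym code-0))
      trivial v vP vQ (no n) = contradiction (code v , n , vP , vQ) d

-- The optimal colouring, uniqueness of the point-pencils and the lower bound

module Colourings (F : Field) (r : ℕ) (size : HasSize F (3 + r)) where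

  open FiniteCounting
  open Arithmetic
  open VectorSpace F (2 + r) size 5
  open LinesAndFlags F (2 + r) size
  open ColourClasses F r size
  open DoubleCounting F r size
  open BlockingSets F r size
  open Translation F r size

  private
    module F = Field F
    module S = Flags F

  -- Choosing the smallest index makes the colour depend only on the set of base points on the line,
  -- hence compatible with `≐F`.
  least : ∀ {n} {A : Fin n → Set} → Decidable A → ∃ A → Fin n
  least {suc n} A? e with A? zero
  ... | yes _ = zero
  least {suc n} A? (zero , a)  | no ¬a = contradiction a ¬a
  least {suc n} A? (suc i , a) | no _  = suc (least (A? ∘ suc) (i , a))

  least-sat : ∀ {n} {A : Fin n → Set} (A? : Decidable A) (e : ∃ A) → A (least A? e)
  least-sat {suc n} A? e with A? zero
  ... | yes a = a
  least-sat {suc n} A? (zero , a)  | no ¬a = contradiction a ¬a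
  least-sat {suc n} A? (suc i , a) | no _  = least-sat (A? ∘ suc) (i , a)

  least-cong : ∀ {n} {A B : Fin n → Set} (A? : Decidable A) (B? : Decidable B) (e : ∃ A) (e′ : ∃ B) →
    (∀ i → A i → B i) → (∀ i → B i → A i) → least A? e ≡ least B? e′
  least-cong {suc n} A? B? e e′ f g with A? zero | B? zero
  ... | yes _ | yes _ = refl
  ... | yes a | no ¬b = contradiction (f zero a) ¬b
  ... | no ¬a | yes b = contradiction (g zero b) ¬a
  least-cong {suc n} A? B? (zero , a) e′ f g | no ¬a | no _ = contradiction a ¬a
  least-cong {suc n} A? B? (suc i , a) (zero , b) f g | no _ | no ¬b = contradiction b ¬b
  least-cong {suc n} A? B? (suc i , a) (suc j , b) f g | no _ | no _ =
    cong suc (least-cong (A? ∘ suc) (B? ∘ suc) (i , a) (j , b) (f ∘ suc) (g ∘ suc))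

  abstract
    -- Greedy choice: every new point uses up p of the vectors still uncovered.
    representatives : ∀ n {U : V → Set} (U? : Decidable U) → (∀ {v} → U v → v ∉ ∅) →
      (∀ {u v} → U v → u ∉ ∅ → u ∈ ∅ ⊹ v → U u) → cnt U? ≤ n * p →
      Σ[ T ∈ (Fin n → V) ] ((∀ i → T i ∉ ∅) × ∀ {v} → U v → ∃[ i ] v ∈ ∅ ⊹ T i)
    representatives zero U? U≢ closed le = (λ ()) , (λ ()) , λ {v} u → contradiction
      (≤-trans (≤-trans (≤-reflexive (sym (⟦⟧-true (U? v) u))) (term≤sum (λ v → ⟦ U? v ⟧) v)) le) λ ()
    representatives (suc n) {U} U? U≢ closed le with any? U?
    ... | no none = (λ _ → proj₁ nonzero-exists) , (λ _ → proj₂ nonzero-exists) , λ {v} u → contradiction (v , u) none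
    ... | yes (v , u) = step (representatives n rest? (λ (u , _) → U≢ u) closed′ fewer)
      where
      Rest : V → Set
      Rest w = U w × w ∉ ∅ ⊹ v
      rest? : Decidable Rest
      rest? w = U? w ×-dec ¬? (w ∈? (∅ ⊹ v))
      on? : Decidable (λ w → w ∈ ∅ ⊹ v × w ∉ ∅)
      on? w = (w ∈? (∅ ⊹ v)) ×-dec ¬? (w ∈? ∅)
      closed′ : ∀ {u w} → Rest w → u ∉ ∅ → u ∈ ∅ ⊹ w → Rest u
      closed′ {u} {w} (uw , w∉) u≢ u∈ = closed uw u≢ u∈ , λ h → w∉ (point-least {u} {∅ ⊹ v} h (point-sym u≢ u∈))
      cnt-on : cnt on? ≡ p
      cnt-on = +-cancelʳ-≡ ∣ ∅ ∣ (cnt on?) p (trans (cnt-∖ {∅} {∅ ⊹ v} ∅-least) (trans (∣point∣ (U≢ u)) (trans (+-comm 1 p) (cong (p +_) (sym ∣∅∣)))))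
      fewer : cnt rest? ≤ n * p
      fewer = +-cancelʳ-≤ p _ _ (≤-trans (≤-reflexive (trans (cong (cnt rest? +_) (sym cnt-on))
          (cnt-⊎-disjoint rest? on? U? split (λ (a , b) → a , λ (c , _) → b c) (λ (h , n) → closed u n h))))
        (≤-trans le (≤-reflexive (+-comm p (n * p)))))
        where
        split : ∀ {w} → U w → Rest w ⊎ (w ∈ ∅ ⊹ v × w ∉ ∅)
        split {w} uw with w ∈? (∅ ⊹ v)
        ... | yes h = inj₂ (h , U≢ uw)
        ... | no h = inj₁ (uw , h)
      step : Σ[ T ∈ (Fin n → V) ] ((∀ i → T i ∉ ∅) × ∀ {w} → Rest w → ∃[ i ] w ∈ ∅ ⊹ T i) →
        Σ[ T ∈ (Fin (suc n) → V) ] ((∀ i → T i ∉ ∅) × ∀ {w} → U w → ∃[ i ] w ∈ ∅ ⊹ T i)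
      step (T , T≢ , cov) = T⁺ , (λ { zero → U≢ u ; (suc i) → T≢ i }) , λ {w} uw → find uw (w ∈? (∅ ⊹ v))
        where
        T⁺ : Fin (suc n) → V
        T⁺ zero    = v
        T⁺ (suc i) = T i
        find : ∀ {w} → U w → Dec (w ∈ ∅ ⊹ v) → ∃[ i ] w ∈ ∅ ⊹ T⁺ i
        find uw (yes h) = zero , h
        find uw (no n) with i , h ← cov (uw , n) = suc i , h

    complete : ∀ {x y} → Ind₂ x y → Σ[ z ∈ V ] Σ[ w ∈ V ] Ind₄ x y z w
    complete {x} {y} i with z , _ , z∉ ← outside-exists {line x y} {⊤} (dim-line i) dim-⊤ (s≤s (s≤s (s≤s z≤n)))
      with w , _ , w∉ ← outside-exists {line x y ⊹ z} {⊤} (dim-⊹ (dim-line i) z∉) dim-⊤ (s≤s (s≤s (s≤s (s≤s z≤n)))) =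
      z , w , i , z∉ , w∉

    line-in : ∀ {W k} → Dim W (2 + k) → Σ[ x ∈ V ] Σ[ y ∈ V ] (Ind₂ x y × line x y ⊆ W)
    line-in {W} dW with x , xW , x∉ ← outside-exists {∅} {W} dim-∅ dW (s≤s z≤n)
      with y , yW , y∉ ← outside-exists {∅ ⊹ x} {W} (dim-point x∉) dW (s≤s (s≤s z≤n)) =
      x , y , (x∉ , y∉) , line-least {x} {y} {W} xW yW

    flag-exists : Flag
    flag-exists with x , y , i , _ ← line-in {⊤} dim-⊤ with z , w , j ← complete i = flag x y z w j

    -- The points of a solid block all lines, because a line meets every hyperplane; q⁴ - 1 = p θ₃ q
    -- is why θ₃ q representatives suffice.
    blocking-points : Σ[ T ∈ (Fin (θ₃ q) → V) ] ((∀ i → T i ∉ ∅) × Blocks T)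
    blocking-points = let T , T≢ , cov = points in T , T≢ , λ ind → on-line T cov (line-meets-hyperplane {S₀} (dim-𝕊 flag-exists) ind)
      where
      S₀ : Sub
      S₀ = 𝕊 flag-exists
      points : Σ[ T ∈ (Fin (θ₃ q) → V) ] ((∀ i → T i ∉ ∅) × ∀ {v} → v ∈ S₀ × v ∉ ∅ → ∃[ i ] v ∈ ∅ ⊹ T i)
      points = representatives (θ₃ q) (λ v → (v ∈? S₀) ×-dec ¬? (v ∈? ∅)) proj₂
        (λ {u} {v} (vS , _) u≢ u∈ → point-least {v} {S₀} vS u∈ , u≢)
        (cnt-∖∅ S₀ (≤-reflexive (trans (card (dim-𝕊 flag-exists)) (trans (q⁴-1 p) (cong suc (*-comm p (θ₃ q)))))))
      on-line : ∀ (T : Fin (θ₃ q) → V) → (∀ {v} → v ∈ S₀ × v ∉ ∅ → ∃[ i ] v ∈ ∅ ⊹ T i) → ∀ {x y} → Meet (line x y) S₀ → ∃[ i ] T i ∈ line x y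
      on-line T cov {x} {y} (v , v≢ , vL , vS) with i , h ← cov (vS , v≢) = i , point-least {v} {line x y} vL (point-sym v≢ h)

  module ByPoint {N : ℕ} (T : Fin N → V) (T≢ : ∀ i → T i ∉ ∅) (blocks : Blocks T) where

    module _ (P : S.Flag24) where
      module A = Decided (S.α P) (S.dimα P)

      on? : Decidable (λ i → T i ∈ A.sub)
      on? i = T i ∈? A.sub

      abstract
        blocked : ∃[ i ] T i ∈ A.sub
        blocked with x , y , ind , LA ← line-in A.dim-sub with i , h ← blocks ind = i , LA h

      first : Fin N
      first = least on? blocked

    abstract
      first-cong : ∀ P Q → P S.≐F Q → first P ≡ first Q
      first-cong P Q ((PQ , QP) , _) = least-cong (on? P) (on? Q) (blocked P) (blocked Q)
        (λ i h → A.∈vec Q (PQ _ (A.vec∈ P h))) (λ i h → A.∈vec P (QP _ (A.vec∈ Q h)))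

      -- Two lines span at most q⁴ vectors. Adjacency therefore forces disjoint lines, while the
      -- lines of flags of equal colour share a point.
      not-spanning : ∀ P Q → ¬ S.SpanAll (S.α P) (S.α Q)
      not-spanning P Q h = <⇒≱ (^-monoʳ-< q (s≤s (s≤s z≤n)) (n<1+n 4)) (≤-trans (≤-reflexive (sym ∣⊤∣))
        (≤-trans (∣∣-mono {⊤} {W} λ {x} _ → all x) (≤-trans (∣⊹∣≤ (A.sub P ⊹ x₁) x₀)
          (*-monoʳ-≤ q (≤-trans (∣⊹∣≤ (A.sub P) x₁) (*-monoʳ-≤ q (≤-reflexive (card (A.dim-sub P)))))))))
        where
        x₀ x₁ : V
        x₀ = code (proj₁ (S.dimα Q) zero)
        x₁ = code (proj₁ (S.dimα Q) (suc zero))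
        W : Sub
        W = A.sub P ⊹ x₁ ⊹ x₀
        all : ∀ x → x ∈ W
        all x with w , u , w∈ , u∈ , e ← h (vec x) = subst (_∈ W)
          (trans (sym (code-+ w u)) (trans (code-cong λ i → F.sym (e i)) (code-vec x)))
          (∈-⊕ W (⊹-old (⊹-old (A.∈⇒ P w∈))) (line-least {x₁} {x₀} {W} (⊹-old ⊹-new) ⊹-new (A.∈⇒ Q u∈)))

      first-proper : ∀ P Q → S.Adjacent P Q → first P ≢ first Q
      first-proper P Q (inj₂ h , _) _ = not-spanning P Q h
      first-proper P Q (inj₁ h , _) e = T≢ (first P) (mk∈ (trans (sym (code-vec _)) (trans (code-cong
        (h (vec (T (first P))) (A.vec∈ P (least-sat (on? P) (blocked P)))
          (A.vec∈ Q (subst (λ i → T i ∈ A.sub Q) (sym e) (least-sat (on? Q) (blocked Q)))))) code-0)))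

    colouring : S.Colouring N
    colouring = record { colour = first ; resp = first-cong ; proper = first-proper }

  point : V → S.Subspace
  point v = subspace (∅ ⊹ v)

  point-⊆ : ∀ {u v} → u ∈ ∅ ⊹ v → point u S.⊆ point v
  point-⊆ {u} {v} h _ = point-least {u} {∅ ⊹ v} h

  module _ {T : S.Subspace} (dT : S.HasDim T 1) where
    private module D = Decided T dT

    abstract
      generator : ∃[ v ] (v ∉ ∅ × S._∈_ T (vec v) × T S.≐ point v)
      generator with v , vD , v≢ ← outside-exists {∅} dim-∅ D.dim-sub (s≤s z≤n) =
        v , v≢ , D.vec∈ vD , (λ u h → dim-unique-⊆ {∅ ⊹ v} {D.sub} (point-least {v} {D.sub} vD) (dim-point v≢) D.dim-sub (D.∈⇒ h))
        , λ u h → D.⇐∈ (point-least {v} {D.sub} vD h)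

  module Structure {N : ℕ} (N≡ : N ≡ θ₃ q) (c : S.Colouring N) where

    col : Flag → Fin N
    col P = S.colour c (toFlag24 P)

    abstract
      nonadjacent : ∀ {P Q} → col P ≡ col Q → Meet (ℓ P) (ℓ Q) ⊎ (ℓ P ⊆ 𝕊 Q ⊎ ℓ Q ⊆ 𝕊 P)
      nonadjacent {P} {Q} e with meet? (ℓ P) (ℓ Q) | ℓ P ⊆? 𝕊 Q | ℓ Q ⊆? 𝕊 P
      ... | yes m | _ | _ = inj₁ m
      ... | no _ | yes h | _ = inj₂ (inj₁ h)
      ... | no _ | no _ | yes h = inj₂ (inj₂ h)
      ... | no d | no PQ | no QP = contradiction e (S.proper c _ _ (adjacent {P} {Q} d PQ QP))

    module C = Colours N≡ col (λ {P} {Q} → nonadjacent {P} {Q})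

    Based : Fin N → V → Set
    Based i v = ∀ P → col P ≡ i → v ∈ ℓ P

    T : Fin N → V
    T i = proj₁ (C.all-pencils i)

    T≢ : ∀ i → T i ∉ ∅
    T≢ i = proj₁ (proj₂ (C.all-pencils i))

    T-based : ∀ i → Based i (T i)
    T-based i = proj₂ (proj₂ (C.all-pencils i))

    abstract
      -- Every line extends to a flag, and the base point for the colour of that flag lies on the
      -- line.
      based⇒blocks : ∀ {T} → (∀ i → Based i (T i)) → Blocks T
      based⇒blocks based {x} {y} ind with z , w , j ← complete ind =
        col (flag x y z w j) , based _ (flag x y z w j) refl

    module B = BlockingSet N≡ T T≢ (based⇒blocks T-based)

    abstract
      -- Replacing `T i` by `v` keeps every class based at its point, so the new points block all
      -- lines as well and `Exchange` applies.
      based-unique : ∀ {i v} → v ∉ ∅ → Based i v → v ∈ ∅ ⊹ T i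
      based-unique {i} {v} v≢ vb = E.exchanged (based⇒blocks T′-based)
        where
        module E = Exchange N≡ T T≢ (based⇒blocks T-based) i v v≢
        T′-based : ∀ j → Based j (E.T′ j)
        T′-based j with j ≟ i
        ... | yes refl = vb
        ... | no _ = T-based j

      in-pencil : ∀ {i v} → Based i v → S.ClassInPencil c i (point v)
      in-pencil {i} {v} vb P e u h with G , PG ← fromFlag24 P =
        proj₂ (proj₁ PG) u (point-least {v} {ℓ G} (vb G (trans (sym (S.resp c P (toFlag24 G) PG)) e)) h)

      pencil-based : ∀ {i T v} → S.ClassInPencil c i T → S._∈_ T (vec v) → Based i v
      pencil-based {v = v} h v∈ G e = subst (_∈ ℓ G) (code-vec v) (h (toFlag24 G) e (vec v) v∈)

      in-pencil-⊆ : ∀ {i T T′} → T S.⊆ T′ → S.ClassInPencil c i T′ → S.ClassInPencil c i T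
      in-pencil-⊆ TT′ h P e u u∈ = h P e u (TT′ u u∈)

    uniquePencil : ∀ i → S.UniquePencil c i
    uniquePencil i = point (T i) , hasDim (dim-point (T≢ i)) , in-pencil (T-based i) , unique
      where
      unique : ∀ T′ → S.HasDim T′ 1 → S.ClassInPencil c i T′ → T′ S.≐ point (T i)
      unique T′ dT h with v , v≢ , v∈ , T′v , vT′ ← generator {T′} dT with based-unique v≢ (pencil-based {T = T′} h v∈)
      ... | v∈Ti = (λ u k → point-⊆ v∈Ti u (T′v u k)) , λ u k → vT′ u (point-⊆ (point-sym v≢ v∈Ti) u k)

    hyperplane : S.BasePointsHyperplane c
    hyperplane = subspace B.H , hasDim B.dim-H , λ T′ dT → inside T′ (generator {T′} dT) , outside T′ (generator {T′} dT)
      where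
      inside : ∀ T′ → ∃[ v ] (v ∉ ∅ × S._∈_ T′ (vec v) × T′ S.≐ point v) → T′ S.⊆ subspace B.H → ∃[ i ] S.ClassInPencil c i T′
      inside T′ (v , v≢ , v∈ , T′v , _) TH with i , h ← B.∈H v≢ (subst (_∈ B.H) (code-vec v) (TH (vec v) v∈)) =
        i , in-pencil-⊆ {T = T′} {point v} T′v (in-pencil λ G e → point-least {T i} {ℓ G} (T-based i G e) h)
      outside : ∀ T′ → ∃[ v ] (v ∉ ∅ × S._∈_ T′ (vec v) × T′ S.≐ point v) → (∃[ i ] S.ClassInPencil c i T′) → T′ S.⊆ subspace B.H
      outside T′ (v , v≢ , v∈ , T′v , _) (i , h) u u∈ =
        point-least {v} {B.H} (point-least {T i} {B.H} (B.T∈H i) (based-unique v≢ (pencil-based {T = T′} h v∈))) (T′v u u∈)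

  -- With fewer colours some class may be taken empty, and the empty class lies in every point-pencil.
  lower-bound : ∀ {N} → N ≡ θ₃ q → ∀ k → S.Colouring k → N ≤ k
  lower-bound {N} N≡ k c = ≮⇒≥ impossible
    where
    impossible : ¬ (k < N)
    impossible k<N = all-points-equal (line-in {⊤} dim-⊤)
      where
      c′ : S.Colouring N
      c′ = record { colour = λ P → inject≤ (S.colour c P) (<⇒≤ k<N)
                  ; resp = λ P Q h → cong (λ j → inject≤ j (<⇒≤ k<N)) (S.resp c P Q h)
                  ; proper = λ P Q a e → S.proper c P Q a (inject≤-injective (<⇒≤ k<N) (<⇒≤ k<N) _ _ e) }
      module St = Structure N≡ c′
      -- The index `k` is the first one not hit by `inject≤`.
      i : Fin N
      i = fromℕ< k<N
      empty : ∀ P → St.col P ≢ i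
      empty P e = <-irrefl (trans (sym (toℕ-inject≤ _ _)) (trans (cong toℕ e) (toℕ-fromℕ< k<N))) (toℕ<n (S.colour c (toFlag24 P)))
      based : ∀ {v} → St.Based i v
      based P e = contradiction e (empty P)
      -- The empty class is based at both `x` and `y`, so both would span the point of `St.T i`,
      -- although they are independent.
      all-points-equal : ¬ (Σ[ x ∈ V ] Σ[ y ∈ V ] (Ind₂ x y × line x y ⊆ ⊤))
      all-points-equal (x , y , (x≢ , y∉) , _) = y∉ (point-least {St.T i} {∅ ⊹ x}
        (point-sym x≢ (St.based-unique x≢ based)) (St.based-unique (λ h → y∉ (∅-least {∅ ⊹ x} h)) based))

theorem1p2 : (q : ℕ) → 3 ≤ q → IsPrimePower q → (F : Field) → HasSize F q →
    let open Flags F in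
    ChromaticNumber (q ^ 3 + q ^ 2 + q + 1)
    × ((c : Colouring (q ^ 3 + q ^ 2 + q + 1)) →
    ((i : Fin (q ^ 3 + q ^ 2 + q + 1)) → UniquePencil c i)
    × BasePointsHyperplane c)
theorem1p2 (suc (suc (suc r))) _ _ F size =
    (optimal , lower-bound N≡) , λ c → Structure.uniquePencil N≡ c , Structure.hyperplane N≡ c
  where
  open Colourings F r size
  N≡ : (3 + r) ^ 3 + (3 + r) ^ 2 + (3 + r) + 1 ≡ Arithmetic.θ₃ (3 + r)
  N≡ = Arithmetic.θ₃-def (3 + r)
  optimal : Flags.Colouring F ((3 + r) ^ 3 + (3 + r) ^ 2 + (3 + r) + 1)
  optimal = subst (Flags.Colouring F) (sym N≡)
    (let T , T≢ , blocks = blocking-points in ByPoint.colouring T T≢ blocks)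
theorem1p2 0 ()
theorem1p2 1 (s≤s ())
theorem1p2 2 (s≤s (s≤s ()))
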